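{- (i) There is an absolute constant $c>0$ such that for all integers $n\ge 2$ and $q\ge 1$ there exist $m$, an antichain $\Pi\subset\{0,1\}^m$ of cardinality $n!$ and a bijection between $\Pi$ and the permutations of $\{0,\ldots,n-1\}$ for which $L(P_{q,\Pi})\le c\,qn\log_2 n$. (ii) There is an absolute constant $c>0$ such that for all integers $n\ge 2$ and $q\ge 1$, $L(P_{q,\Pi_1})\le c\,(qn\log_2 n+n^2)$.
   Context: $L(F)$ denotes the minimal number of gates in a circuit over the basis $\{\vee,\wedge\}$ (binary disjunction and conjunction gates, inputs being the variables) computing the (possibly partially defined) boolean operator $F$; a circuit computes a partially defined operator if its outputs agree with $F$ on every input where $F$ is defined. Let $X=(x_0,\ldots,x_{n-1})$ with $x_i=(x_{i,0},\ldots,x_{i,q-1})^T$ be a $q\times n$ matrix of boolean variables. Given an antichain $\Pi\subset\{0,1\}^m$ of cardinality $n!$ together with a bijection assigning to each element of $\Pi$ a permutation $\pi$ of $\{0,\ldots,n-1\}$, and a vector $Y$ of $m$ boolean variables, the monotone permutation operator $P_{q,\Pi}(X,Y)$ is the partially defined operator defined only for $Y\in\Pi$, with $P_{q,\Pi}(X,Y)=\pi(X)=(x_{\pi(0)},\ldots,x_{\pi(n-1)})$ where $\pi$ is the permutation assigned to $Y$. $\Pi_1\subset\{0,1\}^{n\times n}$ is the set of $n\times n$ permutation matrices $Y=\{y_{j,k}\}$ (every row and column of weight $1$), the permutation assigned to $Y$ being $\pi$ with $\pi(k)$ equal to the row index $j$ of the unique $1$ in column $k$; thus on $\Pi_1$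 the operator $P_{q,\Pi_1}$ coincides with the boolean matrix product $z_{i,k}=\bigvee_{j} x_{i,j}y_{j,k}$. -}

module Defs where

open import Data.Nat using (ℕ; zero; suc; _+_; _*_; _≤_)
open import Data.Nat.Logarithm using (⌈log₂_⌉)
open import Data.Bool using (Bool; true; false; _∨_; _∧_) renaming (_≤_ to _≤ᵇ_)
open import Data.Fin using (Fin; zero; suc)
open import Data.Fin.Permutation using (Permutation′; _⟨$⟩ʳ_)
open import Data.Sum using (_⊎_; inj₁; inj₂)
open import Data.Product using (_×_; _,_; ∃; ∃-syntax; Σ-syntax)
open import Relation.Binary.PropositionalEquality using (_≡_)

data Op : Set where
  OR AND : Op

apply : Op → Bool → Bool → Bool
apply OR  a b = a ∨ b
apply AND a b = a ∧ b

-- A circuit over the basis {∨,∧} with input variables of type V and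
-- outputs indexed by O.  k is the number of gates already built; the
-- available wires are the inputs (inj₁) and the previous gates (inj₂).
-- A circuit is a sequence of binary gates, each reading two already
-- available wires, followed by an assignment of a wire to every output.
data Circuit (V O : Set) : ℕ → Set where
  out  : ∀ {k} → (O → V ⊎ Fin k) → Circuit V O k
  gate : ∀ {k} → Op → V ⊎ Fin k → V ⊎ Fin k → Circuit V O (suc k) → Circuit V O k

size : ∀ {V O k} → Circuit V O k → ℕ
size (out _)          = 0
size (gate _ _ _ C)   = suc (size C)

-- the newest gate becomes wire inj₂ zero
extend : ∀ {V : Set} {k} → (V ⊎ Fin k → Bool) → Bool → (V ⊎ Fin (suc k) → Bool)
extend ρ b (inj₁ v)       = ρ (inj₁ v)
extend ρ b (inj₂ zero)    = b
extend ρ b (inj₂ (suc i)) = ρ (inj₂ i)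

runW : ∀ {V O k} → Circuit V O k → (V ⊎ Fin k → Bool) → O → Bool
runW (out f)          ρ o = ρ (f o)
runW (gate op i j C)  ρ o = runW C (extend ρ (apply op (ρ i) (ρ j))) o

run : ∀ {V O} → Circuit V O 0 → (V → Bool) → O → Bool
run C x = runW C ρ
  where
    ρ : _ ⊎ Fin 0 → Bool
    ρ (inj₁ v) = x v
    ρ (inj₂ ())

Input : ℕ → ℕ → Set → Set
Input q n M = (Fin q × Fin n) ⊎ M

Output : ℕ → ℕ → Set
Output q n = Fin q × Fin n

inputs : ∀ {q n M} → (Fin q → Fin n → Bool) → (M → Bool) → Input q n M → Bool
inputs X Y (inj₁ (i , j)) = X i j
inputs X Y (inj₂ a)       = Y a

-- An antichain Π ⊂ {0,1}^M of cardinality n! together with a bijection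
-- to the permutations of {0,…,n-1}: given as the map σ : permutations → Π
-- (Π is its image), injective (so |Π| = n!) and with antichain image.
record PermCode (n : ℕ) (M : Set) : Set where
  field
    σ         : Permutation′ n → M → Bool
    injective : ∀ π ρ → (∀ a → σ π a ≡ σ ρ a) → ∀ i → π ⟨$⟩ʳ i ≡ ρ ⟨$⟩ʳ i
    antichain : ∀ π ρ → (∀ a → σ π a ≤ᵇ σ ρ a) → ∀ a → σ π a ≡ σ ρ a
open PermCode public

ComputesPerm : ∀ {q n M} → PermCode n M → Circuit (Input q n M) (Output q n) 0 → Set
ComputesPerm {q} {n} S C =
  ∀ (π : Permutation′ n) (X : Fin q → Fin n → Bool) (i : Fin q) (k : Fin n) →
    run C (inputs X (σ S π)) (i , k) ≡ X i (π ⟨$⟩ʳ k)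

IsPermMatrix : ∀ {n} → (Fin n × Fin n → Bool) → Set
IsPermMatrix {n} Y =
  (∀ k → ∃[ j ] (Y (j , k) ≡ true × ∀ j′ → Y (j′ , k) ≡ true → j′ ≡ j)) ×
  (∀ j → ∃[ k ] (Y (j , k) ≡ true × ∀ k′ → Y (j , k′) ≡ true → k′ ≡ k))

-- C computes P_{q,Π₁}: for Y ∈ Π₁, output (i,k) is x_{i,π(k)} where
-- π(k) is the row j of the unique 1 in column k.
ComputesPerm₁ : ∀ {q n} → Circuit (Input q n (Fin n × Fin n)) (Output q n) 0 → Set
ComputesPerm₁ {q} {n} C =
  ∀ (Y : Fin n × Fin n → Bool) → IsPermMatrix Y →
  ∀ (X : Fin q → Fin n → Bool) (i : Fin q) (k : Fin n) (j : Fin n) →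
    Y (j , k) ≡ true → run C (inputs X Y) (i , k) ≡ X i j

-- Pad n to a power of two and route the rows of X through a Beneš network, whose switches cost
-- O(n log n) gates per row.
--
-- (i)  Π consists of the switch settings of the permutations, each bit with its complement.
--
-- (ii) The settings are computed from Y within O(n²) gates.  Each level requires a 2-colouring of
-- the graph joining the inputs, respectively the outputs, that share a switch; it is found by
-- comparing least elements of cycles, which pointer doubling provides.  Pointers are followed by
-- moving data to their addresses, one address bit at a time, with a merge sort whose merging step
-- makes three recursive calls on half the size.  So the cost is 3^d times a polynomial in d, where
-- 2^d ≤ 2n, and hence O(4^d) = O(n²).  All control bits are carried together with their
-- complements, so that ∨ and ∧ suffice.

module Submission where

open import Defs
open import Data.Bool using (Bool; true; false; not; if_then_else_; _∨_; _∧_; _xor_; b≤b; f≤t) renaming (_≤_ to _≤ᵇ_)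
open import Data.Bool.Properties using (not-involutive; not-¬; ¬-not; xor-comm; ∨-identityʳ; ∨-zeroʳ) renaming (_≟_ to _≟ᵇ_)
open import Data.Empty using (⊥)
open import Data.Fin using (Fin; zero; suc; toℕ; inject≤)
open import Data.Fin.Permutation using (Permutation′; _⟨$⟩ʳ_)
open import Data.Fin.Properties using (pigeonhole; toℕ<n; any?; inject≤-injective; 2↔Bool; *↔×; +↔⊎; 0↔⊥; 1↔⊤)
open import Data.Nat using (ℕ; zero; suc; _+_; _*_; _^_; _∸_; ⌊_/2⌋; ⌈_/2⌉; _≤_; _<_; z≤n; s≤s; z<s)
open import Data.Nat.GeneralisedArithmetic using (fold; fold-+)
open import Data.Nat.Logarithm using (⌈log₂_⌉; ⌈log₂⌉-mono-≤; ⌈log₂2^n⌉≡n; ⌈log₂⌈n/2⌉⌉≡⌈log₂n⌉∸1)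
open import Data.Nat.Properties
open import Data.Nat.Tactic.RingSolver using (solve-∀)
open import Data.Product using (_×_; _,_; proj₁; proj₂; ∃; ∃-syntax; Σ-syntax)
open import Data.Product.Function.NonDependent.Propositional using (_×-↔_)
open import Data.Sum using (_⊎_; inj₁; inj₂)
open import Data.Sum.Function.Propositional using (_⊎-↔_)
open import Data.Unit using (⊤; tt)
open import Data.Vec using (Vec; []; _∷_; head; tail; lookup)
open import Data.Vec.Properties using (≡-dec)
open import Function using (_∘_; id; Injective; Inverse; _↔_; mk↔ₛ′)
open import Function.Construct.Composition using (_↔-∘_)
open import Function.Construct.Symmetry using (↔-sym)
open import Relation.Binary.PropositionalEquality
  using (_≡_; _≢_; refl; sym; trans; cong; cong₂; subst; subst₂; module ≡-Reasoning)
open import Relation.Nullary using (Dec; yes; no; contradiction)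

-- Sorting can send data to given addresses, which computes `v ∘ A⁻¹`, whereas following pointers
-- means computing `v ∘ A`. The pointers needed here are powers of a product of two involutions, and
-- conjugation by one of them inverts such a power without any gate. So a doubling costs only two
-- scatters and their comparisons.
--
-- The budget `n²` is what permits so crude a sort: any exponent below 2 would do, and log₂ 3 leaves
-- room for the logarithmic factors contributed by address bits, words and doublings.
--
-- That the operators are partial is exploited. Signals are compared on admissible inputs only, and
-- on permutation matrices even complements of address bits and the two constants are monotone in
-- `Y`. The entries of `X` have no complements; they pass only through selectors, whose controls
-- carry both rails.

Pos : ℕ → Set
Pos = Vec Bool

Inj : {A B : Set} → (A → B) → Set
Inj f = Injective _≡_ _≡_ f

flip : ∀ {d} → Pos (suc d) → Pos (suc d)
flip (b ∷ p) = not b ∷ p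

η-≡ : ∀ {d} {x y : Pos (suc d)} → head x ≡ head y → tail x ≡ tail y → x ≡ y
η-≡ {x = _ ∷ _} {_ ∷ _} refl refl = refl

flip-flip : ∀ {d} (x : Pos (suc d)) → flip (flip x) ≡ x
flip-flip (b ∷ p) = cong (_∷ p) (not-involutive b)

flip-≢ : ∀ {d} (x : Pos (suc d)) → x ≢ flip x
flip-≢ (true ∷ p) ()
flip-≢ (false ∷ p) ()

flip-injective : ∀ {d} → Inj (flip {d})
flip-injective {x = x} {y} eq = trans (sym (flip-flip x)) (trans (cong flip eq) (flip-flip y))

Pos↔Fin : ∀ d → Pos d ↔ Fin (2 ^ d)
Pos↔Fin zero    = ↔-sym 1↔⊤ ↔-∘ mk↔ₛ′ (λ _ → tt) (λ _ → []) (λ _ → refl) (λ { [] → refl })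
Pos↔Fin (suc d) = (↔-sym *↔× ↔-∘ (↔-sym 2↔Bool ×-↔ Pos↔Fin d))
  ↔-∘ mk↔ₛ′ (λ { (b ∷ p) → b , p }) (λ { (b , p) → b ∷ p }) (λ { (_ , _) → refl }) (λ { (_ ∷ _) → refl })

module _ {A B : Set} (i : A ↔ B) where
  open Inverse i

  ↔-to-injective : Inj to
  ↔-to-injective {x} {y} eq = trans (sym (strictlyInverseʳ x)) (trans (cong from eq) (strictlyInverseʳ y))

-- Orbits of an injection on positions

fold-injective : ∀ {A : Set} {f : A → A} → Inj f → ∀ j → Inj (λ x → fold x f j)
fold-injective f-inj zero    eq = eq
fold-injective f-inj (suc j) eq = fold-injective f-inj j (f-inj eq)

fold-suc : ∀ {A : Set} (f : A → A) x j → fold (f x) f j ≡ f (fold x f j)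
fold-suc f x zero    = refl
fold-suc f x (suc j) = cong f (fold-suc f x j)

-- Two of the first `1 + 2 ^ d` iterates coincide, and injectivity cancels the shorter from the
-- longer. The bound on the period is what later lets finitely many doublings exhaust an orbit.
periodic : ∀ {d} {f : Pos d → Pos d} → Inj f → ∀ x → ∃[ r ] (r < 2 ^ d × fold x f (suc r) ≡ x)
periodic {d} {f} f-inj x
  with i , j , i<j , eq ← pigeonhole (n<1+n (2 ^ d)) (λ i → Inverse.to (Pos↔Fin d) (fold x f (toℕ i)))
  = r , ≤-trans r<j (≤-pred (toℕ<n j)) , fold-injective f-inj (toℕ i) (begin
      fold (fold x f (suc r)) f (toℕ i) ≡⟨ fold-+ x f (toℕ i) ⟨
      fold x f (toℕ i + suc r)          ≡⟨ cong (fold x f) i+r ⟩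
      fold x f (toℕ j)                  ≡⟨ ↔-to-injective (Pos↔Fin d) eq ⟨
      fold x f (toℕ i)                  ∎)
  where
  open ≡-Reasoning
  r = toℕ j ∸ suc (toℕ i)
  i+r : toℕ i + suc r ≡ toℕ j
  i+r = trans (+-suc (toℕ i) r) (m+[n∸m]≡n i<j)
  r<j : suc r ≤ toℕ j
  r<j = subst (suc r ≤_) i+r (m≤n+m (suc r) (toℕ i))

injective⇒surjective : ∀ {d} {f : Pos d → Pos d} → Inj f → ∀ y → ∃[ x ] f x ≡ y
injective⇒surjective f-inj y with r , _ , eq ← periodic f-inj y = fold y _ r , eq

-- Lexicographic order on positions

ltb : ∀ {d} → Pos d → Pos d → Bool
ltb []      []      = false
-- `not x ∨ y` can stand for equality of the top bits, since the case in which it is weaker is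
-- already true. So a bit costs four operations.
ltb (x ∷ a) (y ∷ b) = (not x ∧ y) ∨ ((not x ∨ y) ∧ ltb a b)

_≼_ : ∀ {d} → Pos d → Pos d → Set
a ≼ b = ltb b a ≡ false

≼-refl : ∀ {d} (a : Pos d) → a ≼ a
≼-refl []          = refl
≼-refl (true ∷ a)  = ≼-refl a
≼-refl (false ∷ a) = ≼-refl a

≼-antisym : ∀ {d} (a b : Pos d) → a ≼ b → b ≼ a → a ≡ b
≼-antisym []          []          p q = refl
≼-antisym (true ∷ a)  (true ∷ b)  p q = cong (true ∷_) (≼-antisym a b p q)
≼-antisym (false ∷ a) (false ∷ b) p q = cong (false ∷_) (≼-antisym a b p q)

≼-trans : ∀ {d} (a b c : Pos d) → a ≼ b → b ≼ c → a ≼ c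
≼-trans []          []          []          p q = refl
≼-trans (true ∷ a)  (true ∷ b)  (true ∷ c)  p q = ≼-trans a b c p q
≼-trans (false ∷ a) (false ∷ b) (false ∷ c) p q = ≼-trans a b c p q
≼-trans (false ∷ a) (false ∷ b) (true ∷ c)  p q = refl
≼-trans (false ∷ a) (true ∷ b)  (true ∷ c)  p q = refl

ltb-asym : ∀ {d} (a b : Pos d) → ltb a b ≡ true → a ≼ b
ltb-asym []          []          ()
ltb-asym (true ∷ a)  (true ∷ b)  p = ltb-asym a b p
ltb-asym (false ∷ a) (false ∷ b) p = ltb-asym a b p
ltb-asym (false ∷ a) (true ∷ b)  p = refl

min : ∀ {d} → Pos d → Pos d → Pos d
min a b = if ltb b a then b else a

min-≼ˡ : ∀ {d} (a b : Pos d) → min a b ≼ a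
min-≼ˡ a b with ltb b a in eq
... | true  = ltb-asym b a eq
... | false = ≼-refl a

min-≼ʳ : ∀ {d} (a b : Pos d) → min a b ≼ b
min-≼ʳ a b with ltb b a in eq
... | true  = ≼-refl b
... | false = eq

min-sel : ∀ {d} (a b : Pos d) → min a b ≡ a ⊎ min a b ≡ b
min-sel a b with ltb b a
... | true  = inj₂ refl
... | false = inj₁ refl

ltb-flip : ∀ {d} (a b : Pos d) → a ≢ b → ltb a b ≡ not (ltb b a)
ltb-flip a b a≢b with ltb a b in p | ltb b a in q
... | false | true  = refl
... | true  | false = refl
... | true  | true  with () ← trans (sym q) (ltb-asym a b p)
... | false | false = contradiction (≼-antisym a b q p) a≢b

-- Rearrangements and merge sort on Boolean keys

record Rearr {d} {A : Set} (u v : Pos d → A) : Set where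
  constructor rearr
  field
    ρ     : Pos d → Pos d
    ρ-inj : Inj ρ
    ρ-eq  : ∀ x → v x ≡ u (ρ x)

Rearr-refl : ∀ {d} {A : Set} {u : Pos d → A} → Rearr u u
Rearr-refl = rearr id id λ _ → refl

Rearr-trans : ∀ {d} {A : Set} {u v w : Pos d → A} → Rearr u v → Rearr v w → Rearr u w
Rearr-trans (rearr ρ ρ-inj p) (rearr ρ′ ρ′-inj q) =
  rearr (ρ ∘ ρ′) (ρ′-inj ∘ ρ-inj) λ x → trans (q x) (p (ρ′ x))

Rearr-∘ : ∀ {d} {A : Set} (u : Pos d → A) (ρ : Pos d → Pos d) → Inj ρ → Rearr u (u ∘ ρ)
Rearr-∘ u ρ ρ-inj = rearr ρ ρ-inj λ _ → refl

onHalves : ∀ {d} {A : Set} → (Bool → (Pos d → A) → Pos d → A) → (Pos (suc d) → A) → Pos (suc d) → A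
onHalves f u (b ∷ p) = f b (u ∘ (b ∷_)) p

Rearr-onHalves : ∀ {d} {A : Set} (f : Bool → (Pos d → A) → Pos d → A) (u : Pos (suc d) → A) →
                 (∀ b → Rearr (u ∘ (b ∷_)) (f b (u ∘ (b ∷_)))) → Rearr u (onHalves f u)
Rearr-onHalves {d} f u h = rearr ρ ρ-inj λ { (b ∷ p) → Rearr.ρ-eq (h b) p }
  where
  ρ : Pos (suc d) → Pos (suc d)
  ρ (b ∷ p) = b ∷ Rearr.ρ (h b) p
  ρ-inj : Inj ρ
  ρ-inj {b ∷ p} {c ∷ q} eq with refl ← cong head eq = cong (b ∷_) (Rearr.ρ-inj (h b) (cong tail eq))

-- The top bit names the sequence and the next one its half. Exchanging them makes the two lower
-- halves one block and the two upper halves another, ready for the outer merges.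
switchBlocks : ∀ {d} → Pos (2 + d) → Pos (2 + d)
switchBlocks (a ∷ b ∷ p) = b ∷ a ∷ p

-- Brings the two middle quarters together as the upper half.
toMid fromMid : ∀ {d} → Pos (2 + d) → Pos (2 + d)
toMid   (a ∷ b ∷ p) = (a xor b) ∷ a ∷ p
fromMid (c ∷ a ∷ p) = a ∷ (a xor c) ∷ p

switchBlocks-injective : ∀ {d} → Inj (switchBlocks {d})
switchBlocks-injective {x = _ ∷ _ ∷ _} {_ ∷ _ ∷ _} refl = refl

fromMid∘toMid : ∀ {d} (x : Pos (2 + d)) → fromMid (toMid x) ≡ x
fromMid∘toMid (true  ∷ true  ∷ p) = refl
fromMid∘toMid (true  ∷ false ∷ p) = refl
fromMid∘toMid (false ∷ b     ∷ p) = refl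

toMid∘fromMid : ∀ {d} (x : Pos (2 + d)) → toMid (fromMid x) ≡ x
toMid∘fromMid (true  ∷ true  ∷ p) = refl
toMid∘fromMid (false ∷ true  ∷ p) = refl
toMid∘fromMid (b     ∷ false ∷ p) = refl

toMid-injective : ∀ {d} → Inj (toMid {d})
toMid-injective {x = x} {y} eq = trans (sym (fromMid∘toMid x)) (trans (cong fromMid eq) (fromMid∘toMid y))

fromMid-injective : ∀ {d} → Inj (fromMid {d})
fromMid-injective {x = x} {y} eq = trans (sym (toMid∘fromMid x)) (trans (cong toMid eq) (toMid∘fromMid y))

-- The jump from `false` to `true` avoids one of the halves, which is then constant. The proof of
-- merging is a case distinction on that half.
Sorted : ∀ {d} → (Pos d → Bool) → Set
Sorted {zero}  h = ⊤
Sorted {suc d} h = ((∀ p → h (false ∷ p) ≡ false) × Sorted (h ∘ (true ∷_)))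
                 ⊎ (Sorted (h ∘ (false ∷_)) × (∀ p → h (true ∷ p) ≡ true))

Sorted-const : ∀ {d} {h : Pos d → Bool} c → (∀ p → h p ≡ c) → Sorted h
Sorted-const {zero}  c     hc = tt
Sorted-const {suc d} false hc = inj₁ (hc ∘ (false ∷_) , Sorted-const false (hc ∘ (true ∷_)))
Sorted-const {suc d} true  hc = inj₂ (Sorted-const true (hc ∘ (false ∷_)) , hc ∘ (true ∷_))

Sorted-half : ∀ {d} (h : Pos (suc d) → Bool) b → Sorted h → Sorted (h ∘ (b ∷_))
Sorted-half h false (inj₁ (z , _)) = Sorted-const false z
Sorted-half h true  (inj₁ (_ , s)) = s
Sorted-half h false (inj₂ (s , _)) = s
Sorted-half h true  (inj₂ (_ , o)) = Sorted-const true o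

-- Merging two sorted sequences of length 2h by three merges of sequences of length h:
-- lower halves, upper halves, and then the two middle quarters.
module Merging {A : Set} (key : A → Bool) where

  lowerMid : ∀ {d} → ((Pos d → A) → Pos d → A) → Bool → (Pos d → A) → Pos d → A
  lowerMid f false u = u
  lowerMid f true  u = f u

  merge : ∀ d → (Pos (suc d) → A) → Pos (suc d) → A
  -- One key decides: if the first is `true`, exchanging is right whatever the second is.
  merge zero    u (b ∷ []) = u ((key (u (false ∷ [])) xor b) ∷ [])
  merge (suc d) u = onHalves (lowerMid (merge d)) (onHalves (λ _ → merge d) (u ∘ switchBlocks) ∘ fromMid) ∘ toMid

  sort : ∀ d → (Pos d → A) → Pos d → A
  sort zero    u = u
  sort (suc d) u = merge d (onHalves (λ _ → sort d) u)

  merge-Rearr : ∀ d u → Rearr u (merge d u)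
  merge-Rearr zero u = rearr ρ ρ-inj λ { (b ∷ []) → refl }
    where
    ρ : Pos 1 → Pos 1
    ρ (b ∷ []) = (key (u (false ∷ [])) xor b) ∷ []
    ρ-inj : Inj ρ
    ρ-inj {b ∷ []} {c ∷ []} eq with key (u (false ∷ []))
    ... | false = eq
    ... | true  = flip-injective {x = b ∷ []} {c ∷ []} eq
  merge-Rearr (suc d) u =
    Rearr-trans (Rearr-∘ u switchBlocks switchBlocks-injective)
    (Rearr-trans (Rearr-onHalves (λ _ → merge d) _ (λ b → merge-Rearr d _))
    (Rearr-trans (Rearr-∘ _ fromMid fromMid-injective)
    (Rearr-trans (Rearr-onHalves (lowerMid (merge d)) _ λ where
      false → Rearr-refl
      true  → merge-Rearr d _)
    (Rearr-∘ _ toMid toMid-injective))))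

  sort-Rearr : ∀ d u → Rearr u (sort d u)
  sort-Rearr zero    u = Rearr-refl
  sort-Rearr (suc d) u = Rearr-trans (Rearr-onHalves (λ _ → sort d) u (λ b → sort-Rearr d _)) (merge-Rearr d _)

  -- By induction the two outer merges make the first and the third quarter false. The third quarter
  -- is the upper input of the middle merge, which by induction moves its false keys down to the
  -- second quarter.
  merge-low : ∀ d u b → (∀ p → key (u (b ∷ p)) ≡ false) → ∀ p → key (merge d u (false ∷ p)) ≡ false
  merge-low zero u false h [] rewrite h [] = h []
  merge-low zero u true  h [] with key (u (false ∷ [])) in eq
  ... | true  = h []
  ... | false = eq
  merge-low (suc d) u b h (false ∷ p) = merge-low d _ b (λ q → h (false ∷ q)) p
  merge-low (suc d) u b h (true ∷ p)  = merge-low d _ true (λ q → merge-low d _ b (λ r → h (true ∷ r)) q) p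

  merge-high : ∀ d u b → (∀ p → key (u (b ∷ p)) ≡ true) → ∀ p → key (merge d u (true ∷ p)) ≡ true
  merge-high zero u false h [] rewrite h [] = h []
  merge-high zero u true  h [] with key (u (false ∷ [])) in eq
  ... | true  = eq
  ... | false = h []
  merge-high (suc d) u b h (true ∷ p)  = merge-high d _ b (λ q → h (true ∷ q)) p
  merge-high (suc d) u b h (false ∷ p) = merge-high d _ false (λ q → merge-high d _ b (λ r → h (false ∷ r)) q) p

  merge-const : ∀ d u c → (∀ x → key (u x) ≡ c) → ∀ x → key (merge d u x) ≡ c
  merge-const d u c h x with rearr ρ _ eq ← merge-Rearr d u = trans (cong key (eq x)) (h (ρ x))

  -- If the first quarter is false and the last one true after the outer merges, it is enough that
  -- the middle merge sorts. This is so when one input has a false lower half and the other a true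
  -- upper half. If both lower halves are false, `P false` is constant; then either the last quarter
  -- is true as before, or three quarters of the output are false and the last is sorted. Two true
  -- upper halves are dual.
  merge-Sorted : ∀ d u → (∀ b → Sorted (λ p → key (u (b ∷ p)))) → Sorted (key ∘ merge d u)
  merge-Sorted zero u h with key (u (false ∷ [])) in eq
  ... | true  = inj₂ (tt , λ { [] → trans (cong (λ c → key (u ((c xor true) ∷ []))) eq) eq })
  ... | false = inj₁ ((λ { [] → trans (cong (λ c → key (u ((c xor false) ∷ []))) eq) eq }) , tt)
  merge-Sorted (suc d) u h = byLowest (h false) (h true)
    where
    P : Bool → Pos (suc d) → A
    P b = merge d (λ x → u (switchBlocks (b ∷ x)))
    mid : Pos (suc d) → A
    mid x = onHalves (λ _ → merge d) (u ∘ switchBlocks) (fromMid (true ∷ x))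
    M = merge d mid

    P-Sorted : ∀ b → Sorted (key ∘ P b)
    P-Sorted b = merge-Sorted d _ λ where
      false → Sorted-half (key ∘ u ∘ (false ∷_)) b (h false)
      true  → Sorted-half (key ∘ u ∘ (true ∷_)) b (h true)

    M-Sorted : Sorted (key ∘ M)
    M-Sorted = merge-Sorted d mid λ where
      false → Sorted-half (key ∘ P false) true (P-Sorted false)
      true  → Sorted-half (key ∘ P true) false (P-Sorted true)

    fromMiddle : (∀ p → key (P false (false ∷ p)) ≡ false) → (∀ p → key (P true (true ∷ p)) ≡ true) →
                 Sorted (key ∘ M) → Sorted (key ∘ merge (suc d) u)
    fromMiddle P0 P1 (inj₁ (M0 , S)) = inj₁ ((λ { (false ∷ p) → P0 p ; (true ∷ p) → M0 p }) , inj₂ (S , P1))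
    fromMiddle P0 P1 (inj₂ (S , M1)) = inj₂ (inj₁ (P0 , S) , (λ { (false ∷ p) → M1 p ; (true ∷ p) → P1 p }))

    bothLow : (∀ b p → key (u (b ∷ false ∷ p)) ≡ false) → Sorted (key ∘ P true) → Sorted (key ∘ merge (suc d) u)
    bothLow z (inj₂ (_ , P1)) = fromMiddle (merge-low d _ false (z false)) P1 M-Sorted
    bothLow z (inj₁ (P0 , S)) = inj₁ ((λ { (false ∷ p) → Z (false ∷ p) ; (true ∷ p) → MZ (false ∷ p) }) ,
                                      inj₁ (MZ ∘ (true ∷_) , S))
      where
      Z : ∀ x → key (P false x) ≡ false
      Z = merge-const d _ false λ { (b ∷ p) → z b p }
      MZ : ∀ x → key (M x) ≡ false
      MZ = merge-const d mid false λ { (false ∷ p) → Z (true ∷ p) ; (true ∷ p) → P0 p }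

    bothHigh : (∀ b p → key (u (b ∷ true ∷ p)) ≡ true) → Sorted (key ∘ P false) → Sorted (key ∘ merge (suc d) u)
    bothHigh o (inj₁ (P0 , _)) = fromMiddle P0 (merge-high d _ false (o false)) M-Sorted
    bothHigh o (inj₂ (S , P1)) = inj₂ (inj₂ (S , MO ∘ (false ∷_)) ,
                                       (λ { (false ∷ p) → MO (true ∷ p) ; (true ∷ p) → O (true ∷ p) }))
      where
      O : ∀ x → key (P true x) ≡ true
      O = merge-const d _ true λ { (b ∷ p) → o b p }
      MO : ∀ x → key (M x) ≡ true
      MO = merge-const d mid true λ { (false ∷ p) → P1 p ; (true ∷ p) → O (false ∷ p) }

    byLowest : Sorted (λ p → key (u (false ∷ p))) → Sorted (λ p → key (u (true ∷ p))) →
               Sorted (key ∘ merge (suc d) u)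
    byLowest (inj₁ (A0 , _)) (inj₁ (B0 , _)) =
      bothLow (λ { false → A0 ; true → B0 }) (P-Sorted true)
    byLowest (inj₂ (_ , A1)) (inj₂ (_ , B1)) =
      bothHigh (λ { false → A1 ; true → B1 }) (P-Sorted false)
    byLowest (inj₁ (A0 , _)) (inj₂ (_ , B1)) =
      fromMiddle (merge-low d _ false A0) (merge-high d _ true B1) M-Sorted
    byLowest (inj₂ (_ , A1)) (inj₁ (B0 , _)) =
      fromMiddle (merge-low d _ true B0) (merge-high d _ false A1) M-Sorted

  sort-Sorted : ∀ d u → Sorted (key ∘ sort d u)
  sort-Sorted zero    u = tt
  sort-Sorted (suc d) u = merge-Sorted d _ λ b → sort-Sorted d (u ∘ (b ∷_))

open Merging

-- Being injective, `k` takes every address once. The constant half of the sorted keys therefore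
-- exhausts all addresses with its top bit, and the other half is left with the opposite bit.
Sorted-heads : ∀ {d} (k : Pos (suc d) → Pos (suc d)) → Inj k → Sorted (head ∘ k) → ∀ b p → head (k (b ∷ p)) ≡ b
Sorted-heads k k-inj S b p = heads S b p
  where
  constant : ∀ c → (∀ q → head (k (c ∷ q)) ≡ c) → ∀ q → head (k (not c ∷ q)) ≡ not c
  constant c h q = ¬-not λ eq → misplaced eq
    where
    low-inj : Inj (λ r → tail (k (c ∷ r)))
    low-inj {r} {s} eq = cong tail (k-inj (η-≡ (trans (h r) (sym (h s))) eq))
    misplaced : head (k (not c ∷ q)) ≡ c → ⊥
    misplaced eq with r , eq′ ← injective⇒surjective low-inj (tail (k (not c ∷ q)))
      = not-¬ refl (cong head (k-inj (η-≡ (trans (h r) (sym eq)) eq′)))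
  heads : Sorted (head ∘ k) → ∀ b p → head (k (b ∷ p)) ≡ b
  heads (inj₁ (h , _)) false p = h p
  heads (inj₁ (h , _)) true  p = constant false h p
  heads (inj₂ (_ , h)) true  p = h p
  heads (inj₂ (_ , h)) false p = constant true h p

xor-cancelʳ : ∀ a b → (a xor b) xor b ≡ a
xor-cancelʳ true  true  = refl
xor-cancelʳ true  false = refl
xor-cancelʳ false true  = refl
xor-cancelʳ false false = refl

-- Routing by address bits

module _ {w : ℕ} where

  Item : ℕ → Set
  Item d = Pos d × Vec Bool w

  topBit : ∀ {d} → Item (suc d) → Bool
  topBit = head ∘ proj₁

  dropTop : ∀ {d} → Item (suc d) → Item d
  dropTop (k , v) = tail k , v

  route : ∀ d → (Pos d → Item d) → Pos d → Vec Bool w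
  route zero    u p       = proj₂ (u p)
  route (suc d) u (b ∷ p) = route d (λ q → dropTop (sort topBit (suc d) u (b ∷ q))) p

  route-correct : ∀ d u → Inj (proj₁ ∘ u) → ∀ x → route d u (proj₁ (u x)) ≡ proj₂ (u x)
  route-correct zero    u k-inj []  = cong (proj₂ ∘ u) (empty _)
    where
    empty : (p : Pos 0) → p ≡ []
    empty [] = refl
  -- The item is named by its place `y` after the sort, because the recursion runs on the sorted
  -- data.
  route-correct (suc d) u k-inj x with y , refl ← injective⇒surjective (Rearr.ρ-inj (sort-Rearr topBit (suc d) u)) x
    = aux y
    where
    open Rearr (sort-Rearr topBit (suc d) u)
    s : Pos (suc d) → Item (suc d)
    s = sort topBit (suc d) u
    s-inj : Inj (proj₁ ∘ s)
    s-inj {x} {y} eq = ρ-inj (k-inj (trans (sym (cong proj₁ (ρ-eq x))) (trans eq (cong proj₁ (ρ-eq y)))))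
    s-head : ∀ b p → topBit (s (b ∷ p)) ≡ b
    s-head = Sorted-heads (proj₁ ∘ s) s-inj (sort-Sorted topBit (suc d) u)
    tail-inj : ∀ b → Inj (λ p → tail (proj₁ (s (b ∷ p))))
    tail-inj b {p} {q} eq = cong tail (s-inj (η-≡ (trans (s-head b p) (sym (s-head b q))) eq))
    aux : ∀ y → route (suc d) u (proj₁ (u (ρ y))) ≡ proj₂ (u (ρ y))
    aux (b ∷ p) = begin
      route (suc d) u (proj₁ (u (ρ (b ∷ p))))  ≡⟨ cong (route (suc d) u ∘ proj₁) (ρ-eq (b ∷ p)) ⟨
      route (suc d) u (proj₁ (s (b ∷ p)))      ≡⟨ cong (route (suc d) u) (η-≡ {x = proj₁ (s (b ∷ p))} {b ∷ tail (proj₁ (s (b ∷ p)))} (s-head b p) refl) ⟩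
      route d (λ q → dropTop (s (b ∷ q))) (tail (proj₁ (s (b ∷ p))))
                                               ≡⟨ route-correct d (λ q → dropTop (s (b ∷ q))) (tail-inj b) p ⟩
      proj₂ (s (b ∷ p))                        ≡⟨ cong proj₂ (ρ-eq (b ∷ p)) ⟩
      proj₂ (u (ρ (b ∷ p)))                    ∎
      where open ≡-Reasoning

opaque
  -- For injective `k` this is `v ∘ k⁻¹`. It is opaque so that the sort does not unfold in the
  -- algebra of pointers.
  scatter : ∀ {d w} → (Pos d → Pos d) → (Pos d → Vec Bool w) → Pos d → Vec Bool w
  scatter k v = route _ (λ x → k x , v x)

  scatter-correct : ∀ {d w} (k : Pos d → Pos d) (v : Pos d → Vec Bool w) → Inj k → ∀ x → scatter k v (k x) ≡ v x
  scatter-correct k v = route-correct _ (λ x → k x , v x)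

-- Switch settings of the Beneš network

-- Output y of the network is fed from input π y; the outputs y and flip y leave through a
-- common switch, and so do the outputs y and J y = π⁻¹ (flip (π y)) enter.  Hence the two
-- halves of the network have to be assigned so that flip and J both change the half.  The
-- product τ = flip ∘ J preserves it, no τ-orbit is mapped to itself by flip, and so comparing
-- the least elements of the orbits of y and flip y gives a consistent choice.
module Colouring {d : ℕ} (π : Pos (suc d) → Pos (suc d)) where

  inverse J τ : Pos (suc d) → Pos (suc d)
  inverse = scatter π id
  -- Scattering along `inverse` composes with `π` on the right, which gives `π⁻¹ ∘ flip ∘ π`.
  J       = scatter inverse (inverse ∘ flip)
  τ       = flip ∘ J

  -- Equals v ∘ A when A is a power of τ, because flip ∘ A ∘ flip is then the inverse of A.
  compose : (A v : Pos (suc d) → Pos (suc d)) → Pos (suc d) → Pos (suc d)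
  compose A v = scatter (flip ∘ A ∘ flip) v

  -- After i doublings: τ^(2^i), and the least of the first 2^i points of an orbit.
  power least : ℕ → Pos (suc d) → Pos (suc d)
  power zero    = τ
  power (suc i) = compose (power i) (power i)
  least zero    x = x
  least (suc i) x = min (least i x) (compose (power i) (least i) x)

  -- `2 ^ suc d` steps suffice for a whole orbit, since there are no more positions than that.
  leader : Pos (suc d) → Pos (suc d)
  leader = least (suc d)

  -- Setting of the output switch `p`: subnetwork `c` serves output `(c xor colour p) ∷ p`.
  colour : Pos d → Bool
  colour p = ltb (leader (true ∷ p)) (leader (false ∷ p))

  subperm : Bool → Pos d → Pos d
  subperm c p = tail (π ((c xor colour p) ∷ p))

  -- Setting of the input switches. The lower subnetwork serves `colour p ∷ p`; the head of its
  -- source says which port of input switch `subperm false p` leads there. Known per output switch,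
  -- this bit is scattered to the input switch.
  entry : Pos d → Bool
  entry = head ∘ scatter (subperm false) (λ p → head (π (colour p ∷ p)) ∷ [])

  module Correct (π-inj : Inj π) where

    π⁻¹ : Pos (suc d) → Pos (suc d)
    π⁻¹ y = proj₁ (injective⇒surjective π-inj y)

    π-π⁻¹ : ∀ y → π (π⁻¹ y) ≡ y
    π-π⁻¹ y = proj₂ (injective⇒surjective π-inj y)

    inverse-π : ∀ x → inverse (π x) ≡ x
    inverse-π = scatter-correct π id π-inj

    π-inverse : ∀ x → π (inverse x) ≡ x
    π-inverse x = begin
      π (inverse x)             ≡⟨ cong (π ∘ inverse) (π-π⁻¹ x) ⟨
      π (inverse (π (π⁻¹ x)))   ≡⟨ cong π (inverse-π (π⁻¹ x)) ⟩
      π (π⁻¹ x)                 ≡⟨ π-π⁻¹ x ⟩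
      x                         ∎
      where open ≡-Reasoning

    inverse-inj : Inj inverse
    inverse-inj {x} {y} eq = trans (sym (π-inverse x)) (trans (cong π eq) (π-inverse y))

    π-J : ∀ x → π (J x) ≡ flip (π x)
    π-J x = begin
      π (J x)                 ≡⟨ cong (π ∘ J) (inverse-π x) ⟨
      π (J (inverse (π x)))   ≡⟨ cong π (scatter-correct inverse (inverse ∘ flip) inverse-inj (π x)) ⟩
      π (inverse (flip (π x))) ≡⟨ π-inverse (flip (π x)) ⟩
      flip (π x)              ∎
      where open ≡-Reasoning

    J-J : ∀ x → J (J x) ≡ x
    J-J x = π-inj (trans (π-J (J x)) (trans (cong flip (π-J x)) (flip-flip (π x))))

    J-≢ : ∀ x → x ≢ J x
    J-≢ x eq = flip-≢ (π x) (trans (cong π eq) (π-J x))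

    τ-inj : Inj τ
    τ-inj {x} {y} eq = trans (sym (J-J x)) (trans (cong J (flip-injective eq)) (J-J y))

    _^τ_ : Pos (suc d) → ℕ → Pos (suc d)
    x ^τ j = fold x τ j

    -- Conjugating a product of two involutions by one of them inverts it.
    τ-flip : ∀ x → τ (flip (τ x)) ≡ flip x
    τ-flip x = cong flip (trans (cong J (flip-flip (J x))) (J-J x))

    τ^-flip : ∀ j x → flip (flip (x ^τ j) ^τ j) ≡ x
    τ^-flip zero    x = flip-flip x
    τ^-flip (suc j) x = begin
      flip (flip (τ (x ^τ j)) ^τ suc j)         ≡⟨ cong flip (fold-suc τ _ j) ⟨
      flip (τ (flip (τ (x ^τ j))) ^τ j)         ≡⟨ cong (λ y → flip (y ^τ j)) (τ-flip (x ^τ j)) ⟩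
      flip (flip (x ^τ j) ^τ j)                 ≡⟨ τ^-flip j x ⟩
      x                                         ∎
      where open ≡-Reasoning

    compose-correct : ∀ j A v → (∀ x → A x ≡ x ^τ j) → ∀ x → compose A v x ≡ v (A x)
    compose-correct j A v A≗ x = begin
      compose A v x                      ≡⟨ cong (compose A v) undo ⟨
      compose A v (flip (A (flip (A x)))) ≡⟨ scatter-correct (flip ∘ A ∘ flip) v inj (A x) ⟩
      v (A x)                            ∎
      where
      open ≡-Reasoning
      undo : flip (A (flip (A x))) ≡ x
      undo = begin
        flip (A (flip (A x)))         ≡⟨ cong flip (A≗ _) ⟩
        flip (flip (A x) ^τ j)        ≡⟨ cong (λ y → flip (flip y ^τ j)) (A≗ x) ⟩
        flip (flip (x ^τ j) ^τ j)     ≡⟨ τ^-flip j x ⟩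
        x                             ∎
      inj : Inj (flip ∘ A ∘ flip)
      inj {y} {z} eq = flip-injective (fold-injective τ-inj j
        (trans (sym (A≗ (flip y))) (trans (flip-injective eq) (A≗ (flip z)))))

    double : ∀ i x → (x ^τ (2 ^ i)) ^τ (2 ^ i) ≡ x ^τ (2 ^ suc i)
    double i x = trans (sym (fold-+ x τ (2 ^ i))) (cong (λ j → x ^τ (2 ^ i + j)) (sym (+-identityʳ (2 ^ i))))

    power-correct : ∀ i x → power i x ≡ x ^τ (2 ^ i)
    power-correct zero    x = refl
    power-correct (suc i) x = begin
      compose (power i) (power i) x   ≡⟨ compose-correct (2 ^ i) (power i) (power i) (power-correct i) x ⟩
      power i (power i x)             ≡⟨ power-correct i (power i x) ⟩
      power i x ^τ (2 ^ i)            ≡⟨ cong (_^τ (2 ^ i)) (power-correct i x) ⟩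
      (x ^τ (2 ^ i)) ^τ (2 ^ i)       ≡⟨ double i x ⟩
      x ^τ (2 ^ suc i)                ∎
      where open ≡-Reasoning

    least-suc : ∀ i x → least (suc i) x ≡ min (least i x) (least i (x ^τ (2 ^ i)))
    least-suc i x = cong (min (least i x))
      (trans (compose-correct (2 ^ i) (power i) (least i) (power-correct i) x)
             (cong (least i) (power-correct i x)))

    least-≼ : ∀ i x j → j < 2 ^ i → least i x ≼ (x ^τ j)
    least-≼ zero    x zero    j< = ≼-refl x
    least-≼ zero    x (suc j) (s≤s ())
    least-≼ (suc i) x j       j< = subst (_≼ (x ^τ j)) (sym (least-suc i x)) (bound (<-≤-connex j (2 ^ i)))
      where
      y = x ^τ (2 ^ i)
      bound : j < 2 ^ i ⊎ 2 ^ i ≤ j → min (least i x) (least i y) ≼ (x ^τ j)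
      bound (inj₁ j<′) = ≼-trans (min (least i x) (least i y)) (least i x) (x ^τ j)
        (min-≼ˡ (least i x) (least i y)) (least-≼ i x j j<′)
      bound (inj₂ j≥)  = ≼-trans (min (least i x) (least i y)) (least i y) (x ^τ j)
        (min-≼ʳ (least i x) (least i y)) (subst (least i y ≼_) eq (least-≼ i y (j ∸ 2 ^ i) j∸<))
        where
        eq : y ^τ (j ∸ 2 ^ i) ≡ x ^τ j
        eq = trans (sym (fold-+ x τ (j ∸ 2 ^ i))) (cong (x ^τ_) (m∸n+n≡m j≥))
        j∸< : j ∸ 2 ^ i < 2 ^ i
        j∸< = +-cancelʳ-< (2 ^ i) _ _ (subst (_< 2 ^ i + 2 ^ i) (sym (m∸n+n≡m j≥))
                (subst (j <_) (cong (2 ^ i +_) (+-identityʳ (2 ^ i))) j<))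

    least-∈ : ∀ i x → ∃[ j ] least i x ≡ x ^τ j
    least-∈ zero    x = 0 , refl
    least-∈ (suc i) x with min-sel (least i x) (least i (x ^τ (2 ^ i)))
    ... | inj₁ eq = proj₁ (least-∈ i x) , trans (least-suc i x) (trans eq (proj₂ (least-∈ i x)))
    ... | inj₂ eq with j , eq′ ← least-∈ i (x ^τ (2 ^ i)) =
      j + 2 ^ i , trans (least-suc i x) (trans eq (trans eq′ (sym (fold-+ x τ j))))

    -- Exponents grow by one; on reaching `2 ^ suc d` they drop by the period, which is positive and
    -- no larger than that.
    reduce : ∀ x j → ∃[ i ] (i < 2 ^ suc d × x ^τ j ≡ x ^τ i)
    reduce x zero    = 0 , m^n>0 2 (suc d) , refl
    reduce x (suc j) = step (reduce x j)
      where
      open ≡-Reasoning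
      wrap : ∀ i → suc i ≡ 2 ^ suc d → ∃[ r ] (r < 2 ^ suc d × x ^τ suc r ≡ x) →
             ∃[ i′ ] (i′ < 2 ^ suc d × x ^τ suc i ≡ x ^τ i′)
      wrap i si≡ (r , r< , per) = 2 ^ suc d ∸ suc r , ∸-monoʳ-< {o = 0} z<s r< , (begin
        x ^τ suc i                               ≡⟨ cong (x ^τ_) (trans si≡ (sym (m∸n+n≡m r<))) ⟩
        x ^τ ((2 ^ suc d ∸ suc r) + suc r)       ≡⟨ fold-+ x τ (2 ^ suc d ∸ suc r) ⟩
        (x ^τ suc r) ^τ (2 ^ suc d ∸ suc r)      ≡⟨ cong (_^τ (2 ^ suc d ∸ suc r)) per ⟩
        x ^τ (2 ^ suc d ∸ suc r)                 ∎)
      step : ∃[ i ] (i < 2 ^ suc d × x ^τ j ≡ x ^τ i) → ∃[ i ] (i < 2 ^ suc d × x ^τ suc j ≡ x ^τ i)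
      step (i , i< , eq) with m≤n⇒m<n∨m≡n i<
      ... | inj₁ si< = suc i , si< , cong τ eq
      ... | inj₂ si≡ = let i′ , i′< , eq′ = wrap i si≡ (periodic τ-inj x) in i′ , i′< , trans (cong τ eq) eq′

    leader-≼ : ∀ x j → leader x ≼ (x ^τ j)
    leader-≼ x j with i , i< , eq ← reduce x j = subst (leader x ≼_) (sym eq) (least-≼ (suc d) x i i<)

    -- The orbit of `τ x` is contained in that of `x`, and periodicity brings it back to `x`.
    leader-τ : ∀ x → leader (τ x) ≡ leader x
    leader-τ x = ≼-antisym (leader (τ x)) (leader x) (τx≼x (least-∈ (suc d) x) (periodic τ-inj x)) (x≼τx (least-∈ (suc d) (τ x)))
      where
      x≼τx : ∃[ j ] leader (τ x) ≡ τ x ^τ j → leader x ≼ leader (τ x)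
      x≼τx (j , eq) = subst (leader x ≼_) (trans (sym (fold-suc τ x j)) (sym eq)) (leader-≼ x (suc j))
      τx≼x : ∃[ i ] leader x ≡ x ^τ i → ∃[ r ] (r < 2 ^ suc d × x ^τ suc r ≡ x) → leader (τ x) ≼ leader x
      τx≼x (i , eq) (r , _ , per) = subst (leader (τ x) ≼_)
        (trans (fold-+ (τ x) τ i) (trans (cong (_^τ i) (trans (fold-suc τ x r) per)) (sym eq)))
        (leader-≼ (τ x) (i + r))

    halve : ∀ n → ∃[ k ] (n ≡ k + k ⊎ n ≡ suc (k + k))
    halve zero = 0 , inj₁ refl
    halve (suc n) with halve n
    ... | k , inj₁ eq = k , inj₂ (cong suc eq)
    ... | k , inj₂ eq = suc k , inj₁ (cong suc (trans eq (sym (+-suc k k))))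

    -- A point meeting its flip along the orbit would give a fixed point of flip or of J halfway.
    flip-∉-orbit : ∀ y n → flip y ^τ n ≢ y
    flip-∉-orbit y n eq with halve n
    ... | k , inj₁ refl = flip-≢ z (fold-injective τ-inj k (begin
      z ^τ k                 ≡⟨ fold-+ (flip y) τ k ⟨
      flip y ^τ (k + k)      ≡⟨ eq ⟩
      y                      ≡⟨ flip-z ⟨
      flip z ^τ k            ∎))
      where
      open ≡-Reasoning
      z = flip y ^τ k
      flip-z : flip z ^τ k ≡ y
      flip-z = flip-injective (τ^-flip k (flip y))
    ... | k , inj₂ refl = J-≢ z (flip-injective (fold-injective τ-inj k (begin
      flip z ^τ k            ≡⟨ flip-z ⟩
      y                      ≡⟨ eq ⟨
      τ (flip y ^τ (k + k))  ≡⟨ cong τ (fold-+ (flip y) τ k) ⟩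
      τ (z ^τ k)             ≡⟨ fold-suc τ z k ⟨
      τ z ^τ k               ∎)))
      where
      open ≡-Reasoning
      z = flip y ^τ k
      flip-z : flip z ^τ k ≡ y
      flip-z = flip-injective (τ^-flip k (flip y))

    -- A common leader `y` would be both `x ^τ i` and `flip x ^τ j`. Since `flip` reverses `τ`, `j`
    -- steps lead from `flip y` to `x` and `i` more to `y`, contrary to `flip-∉-orbit`.
    leader-flip : ∀ x → leader x ≢ leader (flip x)
    leader-flip x eq with i , p ← least-∈ (suc d) x | j , q ← least-∈ (suc d) (flip x) =
      flip-∉-orbit y (i + j) (begin
        flip y ^τ (i + j)             ≡⟨ fold-+ (flip y) τ i ⟩
        (flip y ^τ j) ^τ i            ≡⟨ cong (λ z → (flip z ^τ j) ^τ i) (trans (sym p) (trans eq q)) ⟩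
        (flip (flip x ^τ j) ^τ j) ^τ i ≡⟨ cong (_^τ i) (flip-injective (τ^-flip j (flip x))) ⟩
        y                             ∎)
      where
      open ≡-Reasoning
      y = x ^τ i

    -- The subnetwork that serves output `y`; `colour p` is its value at `false ∷ p`.
    half : Pos (suc d) → Bool
    half y = ltb (leader (flip y)) (leader y)

    half-flip : ∀ y → half (flip y) ≡ not (half y)
    half-flip y = trans (cong (λ z → ltb (leader z) (leader (flip y))) (flip-flip y))
                        (ltb-flip (leader y) (leader (flip y)) (leader-flip y))

    half-τ : ∀ y → half (τ y) ≡ half y
    half-τ y = cong₂ ltb (trans (sym (leader-τ (flip (τ y)))) (cong leader (τ-flip y))) (leader-τ y)

    half-J : ∀ y → half (J y) ≡ not (half y)
    half-J y = begin
      half (J y)               ≡⟨ not-involutive _ ⟨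
      not (not (half (J y)))   ≡⟨ cong not (half-flip (J y)) ⟨
      not (half (τ y))         ≡⟨ cong not (half-τ y) ⟩
      not (half y)             ∎
      where open ≡-Reasoning

    half-colour : ∀ b p → half (b ∷ p) ≡ b xor colour p
    half-colour false p = refl
    half-colour true  p = half-flip (false ∷ p)

    outlet : Bool → Pos d → Pos (suc d)
    outlet c p = (c xor colour p) ∷ p

    half-outlet : ∀ c p → half (outlet c p) ≡ c
    half-outlet c p = trans (half-colour (c xor colour p) p) (xor-cancelʳ c (colour p))

    outlet-half : ∀ b p → outlet (half (b ∷ p)) p ≡ b ∷ p
    outlet-half b p = cong (_∷ p) (trans (cong (_xor colour p) (half-colour b p)) (xor-cancelʳ b (colour p)))

    tail-π : ∀ x y → tail (π x) ≡ tail (π y) → x ≡ y ⊎ x ≡ J y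
    tail-π x y eq with head (π x) ≟ᵇ head (π y)
    ... | yes h≡ = inj₁ (π-inj (η-≡ h≡ eq))
    ... | no h≢  = inj₂ (π-inj (trans (η-≡′ (¬-not h≢) eq) (sym (π-J y))))
      where
      η-≡′ : {a b : Pos (suc d)} → head a ≡ not (head b) → tail a ≡ tail b → a ≡ flip b
      η-≡′ {_ ∷ _} {_ ∷ _} refl refl = refl

    -- Distinct outputs whose sources share an input switch are exchanged by `J`, hence belong to
    -- different subnetworks.
    subperm-inj : ∀ c → Inj (subperm c)
    subperm-inj c {p} {q} eq with tail-π (outlet c p) (outlet c q) eq
    ... | inj₁ e = cong tail e
    ... | inj₂ e = contradiction
      (trans (sym (half-outlet c p)) (trans (cong half e) (trans (half-J (outlet c q)) (cong not (half-outlet c q)))))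
      (not-¬ refl)

    entry-lower : ∀ y → half y ≡ false → entry (tail (π y)) ≡ head (π y)
    entry-lower (b ∷ q) eq = trans (cong (entry ∘ tail ∘ π) (sym y≡)) (trans
        (cong head (scatter-correct (subperm false) (λ p → head (π (colour p ∷ p)) ∷ []) (subperm-inj false) q))
        (cong (head ∘ π) y≡))
      where
      y≡ : outlet false q ≡ b ∷ q
      y≡ = trans (cong (λ c → outlet c q) (sym eq)) (outlet-half b q)

    -- `entry` is read off the outputs of the lower half. For `y` in the upper half, `J y` is in the
    -- lower one and its source is the other port of the same switch.
    entry-correct : ∀ y → entry (tail (π y)) ≡ half y xor head (π y)
    entry-correct y with half y in eq
    ... | false = entry-lower y eq
    ... | true  = begin
      entry (tail (π y))          ≡⟨ cong entry (tail-flip (π y)) ⟨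
      entry (tail (flip (π y)))   ≡⟨ cong (entry ∘ tail) (π-J y) ⟨
      entry (tail (π (J y)))      ≡⟨ entry-lower (J y) (trans (half-J y) (cong not eq)) ⟩
      head (π (J y))              ≡⟨ cong head (π-J y) ⟩
      head (flip (π y))           ≡⟨ head-flip (π y) ⟩
      not (head (π y))            ∎
      where
      open ≡-Reasoning
      tail-flip : (x : Pos (suc d)) → tail (flip x) ≡ tail x
      tail-flip (_ ∷ _) = refl
      head-flip : (x : Pos (suc d)) → head (flip x) ≡ not (head x)
      head-flip (_ ∷ _) = refl

-- The Beneš network and its control bits

Ctl : ℕ → Set
Ctl zero    = ⊥
-- Input switches, output switches, and the controls of the two subnetworks.
Ctl (suc d) = (Pos d ⊎ Pos d) ⊎ (Bool × Ctl d)

settings : ∀ d → (Pos d → Pos d) → Ctl d → Bool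
settings (suc d) π (inj₁ (inj₁ p))  = Colouring.entry π p
settings (suc d) π (inj₁ (inj₂ p))  = Colouring.colour π p
settings (suc d) π (inj₂ (c , k))   = settings d (Colouring.subperm π c) k

beneš : ∀ {A : Set} d → (Ctl d → Bool) → (Pos d → A) → Pos d → A
beneš zero    s x p       = x p
beneš (suc d) s x (b ∷ q) =
  beneš d (λ k → s (inj₂ (c , k))) (λ p → x ((s (inj₁ (inj₁ p)) xor c) ∷ p)) q
  where c = s (inj₁ (inj₂ q)) xor b

beneš-cong : ∀ {A : Set} d {s t : Ctl d → Bool} {x y : Pos d → A} →
             (∀ k → s k ≡ t k) → (∀ p → x p ≡ y p) → ∀ p → beneš d s x p ≡ beneš d t y p
beneš-cong zero    s≗t x≗y p = x≗y p
beneš-cong (suc d) {s} {t} {x} {y} s≗t x≗y (b ∷ q) rewrite s≗t (inj₁ (inj₂ q)) =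
  beneš-cong d (λ k → s≗t (inj₂ (_ , k)))
    (λ p → trans (x≗y _) (cong (λ a → y ((a xor (t (inj₁ (inj₂ q)) xor b)) ∷ p)) (s≗t (inj₁ (inj₁ p))))) q

beneš-correct : ∀ {A : Set} d {π : Pos d → Pos d} → Inj π → (x : Pos d → A) →
                ∀ p → beneš d (settings d π) x p ≡ x (π p)
beneš-correct zero    {π} π-inj x [] with [] ← π [] = refl
beneš-correct (suc d) {π} π-inj x (b ∷ q) = begin
  beneš d (settings d (subperm c)) (λ p → x ((entry p xor c) ∷ p)) q
    ≡⟨ beneš-correct d (subperm-inj c) (λ p → x ((entry p xor c) ∷ p)) q ⟩
  x ((entry (subperm c q) xor c) ∷ subperm c q)
    ≡⟨ cong (λ y → x ((entry (tail (π y)) xor c) ∷ tail (π y))) outlet≡ ⟩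
  x ((entry (tail (π (b ∷ q))) xor c) ∷ tail (π (b ∷ q)))
    ≡⟨ cong x (η-≡ head≡ refl) ⟩
  x (π (b ∷ q)) ∎
  where
  open ≡-Reasoning
  open Colouring π
  open Correct π-inj
  c = colour q xor b
  c≡ : c ≡ half (b ∷ q)
  c≡ = trans (xor-comm (colour q) b) (sym (half-colour b q))
  outlet≡ : outlet c q ≡ b ∷ q
  outlet≡ = trans (cong (λ a → outlet a q) c≡) (outlet-half b q)
  head≡ : entry (tail (π (b ∷ q))) xor c ≡ head (π (b ∷ q))
  head≡ = begin
    entry (tail (π (b ∷ q))) xor c                    ≡⟨ cong₂ _xor_ (entry-correct (b ∷ q)) c≡ ⟩
    (half (b ∷ q) xor head (π (b ∷ q))) xor half (b ∷ q) ≡⟨ cong (_xor half (b ∷ q)) (xor-comm (half (b ∷ q)) _) ⟩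
    (head (π (b ∷ q)) xor half (b ∷ q)) xor half (b ∷ q) ≡⟨ xor-cancelʳ _ _ ⟩
    head (π (b ∷ q)) ∎

Ctl-count : ℕ → ℕ
Ctl-count zero    = 0
Ctl-count (suc d) = (2 ^ d + 2 ^ d) + 2 * Ctl-count d

Ctl↔Fin : ∀ d → Ctl d ↔ Fin (Ctl-count d)
Ctl↔Fin zero    = ↔-sym 0↔⊥
Ctl↔Fin (suc d) =
  ↔-sym +↔⊎ ↔-∘ ((↔-sym +↔⊎ ↔-∘ (Pos↔Fin d ⊎-↔ Pos↔Fin d)) ⊎-↔ (↔-sym *↔× ↔-∘ (↔-sym 2↔Bool ×-↔ Ctl↔Fin d)))

-- Circuit construction

rail : Bool → Bool → Bool
rail true  b = b
rail false b = not b

rail-∧ : ∀ a b → rail false a ∨ rail false b ≡ rail false (a ∧ b)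
rail-∧ true  b = refl
rail-∧ false b = refl

rail-∨ : ∀ a b → rail false a ∧ rail false b ≡ rail false (a ∨ b)
rail-∨ true  b = refl
rail-∨ false b = refl

-- `E` consists of the admissible inputs. Wires have to agree with their signals on these only,
-- which is how the partial operators enter.
module Build {V E : Set} (inp : E → V → Bool) where

  infixl 5 _▷_
  -- A `Circuit` exposes its first gate; construction needs to append at the end.
  data Prefix : ℕ → Set where
    ε   : Prefix 0
    _▷_ : ∀ {k} → Prefix k → Op × (V ⊎ Fin k) × (V ⊎ Fin k) → Prefix (suc k)

  eval : ∀ {k} → Prefix k → (V → Bool) → V ⊎ Fin k → Bool
  eval ε                  x (inj₁ v) = x v
  eval (p ▷ (op , i , j)) x          = extend (eval p x) (apply op (eval p x i) (eval p x j))

  plug : ∀ {O k} → Prefix k → Circuit V O k → Circuit V O 0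
  plug ε                  C = C
  plug (p ▷ (op , i , j)) C = plug p (gate op i j C)

  size-plug : ∀ {O k} (p : Prefix k) (C : Circuit V O k) → size (plug p C) ≡ k + size C
  size-plug ε       C = refl
  size-plug {k = suc k} (p ▷ g) C = trans (size-plug p _) (+-suc k (size C))

  extend-cong : ∀ {k} {ρ ρ′ : V ⊎ Fin k → Bool} {b b′} → (∀ w → ρ w ≡ ρ′ w) → b ≡ b′ →
                ∀ w → extend ρ b w ≡ extend ρ′ b′ w
  extend-cong ρ≗ b≡ (inj₁ v)       = ρ≗ (inj₁ v)
  extend-cong ρ≗ b≡ (inj₂ zero)    = b≡
  extend-cong ρ≗ b≡ (inj₂ (suc i)) = ρ≗ (inj₂ i)

  runW-cong : ∀ {O k} (C : Circuit V O k) {ρ ρ′ : V ⊎ Fin k → Bool} → (∀ w → ρ w ≡ ρ′ w) →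
              ∀ o → runW C ρ o ≡ runW C ρ′ o
  runW-cong (out f)         ρ≗ o = ρ≗ (f o)
  runW-cong (gate op i j C) ρ≗ o = runW-cong C (extend-cong ρ≗ (cong₂ (apply op) (ρ≗ i) (ρ≗ j))) o

  run-plug : ∀ {O k} (p : Prefix k) (C : Circuit V O k) x o → run (plug p C) x o ≡ runW C (eval p x) o
  run-plug ε       C x o = runW-cong C (λ { (inj₁ v) → refl ; (inj₂ ()) }) o
  run-plug (p ▷ g) C x o = run-plug p _ x o

  Signal : Set
  Signal = E → Bool

  infixr 6 _⊗_
  -- `sig` is a single rail, all that is available for the entries of `X`; `dual` is a signal with
  -- its complement.
  data Goal : Set₁ where
    sig dual : Signal → Goal
    word     : ∀ {w} → (E → Vec Bool w) → Goal
    _⊗_      : Goal → Goal → Goal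
    all      : (I : Set) → (I → Goal) → Goal

  -- The signals of the goal are carried by wires of the prefix.
  infix 4 _⊩_
  infixr 4 _,_
  data _⊩_ {k} (p : Prefix k) : Goal → Set₁ where
    wire  : ∀ {s} w → (∀ e → eval p (inp e) w ≡ s e) → p ⊩ sig s
    rails : ∀ {s} → (∀ r → p ⊩ sig (λ e → rail r (s e))) → p ⊩ dual s
    bits  : ∀ {w} {u : E → Vec Bool w} → (∀ i → p ⊩ dual (λ e → lookup (u e) i)) → p ⊩ word u
    _,_   : ∀ {G H} → p ⊩ G → p ⊩ H → p ⊩ G ⊗ H
    table : ∀ {I G} → (∀ i → p ⊩ G i) → p ⊩ all I G

  infixl 20 _·_ _↾_ _!_
  fst : ∀ {k} {p : Prefix k} {G H} → p ⊩ G ⊗ H → p ⊩ G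
  fst (g , _) = g

  snd : ∀ {k} {p : Prefix k} {G H} → p ⊩ G ⊗ H → p ⊩ H
  snd (_ , h) = h

  _·_ : ∀ {k} {p : Prefix k} {I G} → p ⊩ all I G → ∀ i → p ⊩ G i
  table h · i = h i

  _↾_ : ∀ {k} {p : Prefix k} {s} → p ⊩ dual s → ∀ r → p ⊩ sig (λ e → rail r (s e))
  rails h ↾ r = h r

  _!_ : ∀ {k} {p : Prefix k} {w} {u : E → Vec Bool w} → p ⊩ word u → ∀ i → p ⊩ dual (λ e → lookup (u e) i)
  bits h ! i = h i

  infix 4 _⊨_
  _⊨_ : Goal → Goal → Set₁
  G ⊨ H = ∀ {k} {p : Prefix k} → p ⊩ G → p ⊩ H

  record Extension {k} (p : Prefix k) (c : ℕ) (H : Goal) : Set₁ where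
    constructor extension
    field
      {k′}  : ℕ
      p′    : Prefix k′
      keep  : ∀ {s} → p ⊩ sig s → p′ ⊩ sig s
      cost  : k′ ≤ c + k
      holds : p′ ⊩ H

  infix 4 _⊢[_]_
  -- Quantifying over the prefix lets later pieces reuse all wires built before, so costs simply add
  -- up in `cut`.
  record _⊢[_]_ (G : Goal) (c : ℕ) (H : Goal) : Set₁ where
    constructor derivation
    field build : ∀ {k} (p : Prefix k) → p ⊩ G → Extension p c H
  open _⊢[_]_

  keepAll : ∀ {k k′} {p : Prefix k} {p′ : Prefix k′} → (∀ {s} → p ⊩ sig s → p′ ⊩ sig s) → ∀ {G} → p ⊩ G → p′ ⊩ G
  keepAll f (wire w h) = f (wire w h)
  keepAll f (rails h)  = rails λ r → keepAll f (h r)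
  keepAll f (bits h)   = bits λ i → keepAll f (h i)
  keepAll f (g , h)    = keepAll f g , keepAll f h
  keepAll f (table h)  = table λ i → keepAll f (h i)

  free : ∀ {G H} → G ⊨ H → G ⊢[ 0 ] H
  free f = derivation λ p g → extension p id ≤-refl (f g)

  from : ∀ {G G′ c H} → G ⊨ G′ → G′ ⊢[ c ] H → G ⊢[ c ] H
  from f d = derivation λ p g → build d p (f g)

  to : ∀ {G c H H′} → H ⊨ H′ → G ⊢[ c ] H → G ⊢[ c ] H′
  to f d = derivation λ p g → let extension p′ keep cost h = build d p g in extension p′ keep cost (f h)

  relax : ∀ {G c c′ H} → c ≤ c′ → G ⊢[ c ] H → G ⊢[ c′ ] H
  relax c≤ d = derivation λ {k} p g → let extension p′ keep cost h = build d p g in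
    extension p′ keep (≤-trans cost (+-monoˡ-≤ k c≤)) h

  cut : ∀ {G a H b K} → G ⊢[ a ] H → G ⊗ H ⊢[ b ] K → G ⊢[ a + b ] K
  cut {a = a} {b = b} d e = derivation λ {k} p g →
    let extension p₁ keep₁ cost₁ h = build d p g
        extension p₂ keep₂ cost₂ l = build e p₁ (keepAll keep₁ g , h)
    in extension p₂ (keep₂ ∘ keep₁)
         (≤-trans cost₂ (≤-trans (+-monoʳ-≤ b cost₁) (≤-reflexive (lemma a b k)))) l
    where
    lemma : ∀ a b k → b + (a + k) ≡ a + b + k
    lemma = solve-∀

  keeping : ∀ {G c H} → G ⊢[ c ] H → G ⊢[ c ] G ⊗ H
  keeping d = derivation λ p g → let extension p′ keep cost h = build d p g in extension p′ keep cost (keepAll keep g , h)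

  both : ∀ {G a H b K} → G ⊢[ a ] H → G ⊢[ b ] K → G ⊢[ a + b ] H ⊗ K
  both d e = cut d (to (λ { ((_ , h) , k) → h , k }) (keeping (from (λ { (g , _) → g }) e)))

  forBool : ∀ {G c H} → (∀ b → G ⊢[ c ] H b) → G ⊢[ 2 * c ] all Bool H
  forBool {c = c} d = relax (≤-reflexive (cong (c +_) (sym (+-identityʳ c))))
    (to (λ { (f , t) → table λ { false → f ; true → t } }) (both (d false) (d true)))

  forFin : ∀ {G c} n {H : Fin n → Goal} → (∀ i → G ⊢[ c ] H i) → G ⊢[ n * c ] all (Fin n) H
  forFin zero    d = free λ _ → table λ ()
  forFin (suc n) d = to (λ { (h , hs) → table λ { zero → h ; (suc i) → hs · i } })
    (both (d zero) (forFin n (λ i → d (suc i))))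

  forPos : ∀ {G c} d {H : Pos d → Goal} → (∀ x → G ⊢[ c ] H x) → G ⊢[ 2 ^ d * c ] all (Pos d) H
  forPos {c = c} zero h = relax (≤-reflexive (sym (+-identityʳ c))) (to (λ l → table λ { [] → l }) (h []))
  forPos {c = c} (suc d) h = relax (≤-reflexive (sym (*-assoc 2 (2 ^ d) c)))
    (to (λ l → table λ { (b ∷ p) → l · b · p }) (forBool λ b → forPos d λ p → h (b ∷ p)))

  gate-⊢ : ∀ op {s t} → sig s ⊗ sig t ⊢[ 1 ] sig (λ e → apply op (s e) (t e))
  gate-⊢ op = derivation λ { p (wire i hi , wire j hj) → extension (p ▷ (op , i , j))
    (λ { (wire (inj₁ v) h) → wire (inj₁ v) h ; (wire (inj₂ w) h) → wire (inj₂ (suc w)) h })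
    ≤-refl (wire (inj₂ zero) λ e → cong₂ (apply op) (hi e) (hj e)) }

  sig-cong : ∀ {s t} → (∀ e → s e ≡ t e) → sig s ⊨ sig t
  sig-cong s≗t (wire w h) = wire w λ e → trans (h e) (s≗t e)

  wireOf : ∀ {k} {p : Prefix k} {s} → p ⊩ sig s → V ⊎ Fin k
  wireOf (wire w _) = w

  wireOf-eval : ∀ {k} {p : Prefix k} {s} (h : p ⊩ sig s) e → eval p (inp e) (wireOf h) ≡ s e
  wireOf-eval (wire _ h) = h

  circuit : ∀ {G c O} {F : O → Signal} → ε ⊩ G → G ⊢[ c ] all O (λ o → sig (F o)) →
            Σ[ C ∈ Circuit V O 0 ] (size C ≤ c × ∀ e o → run C (inp e) o ≡ F o e)
  circuit {c = c} g d =
    plug p′ outs ,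
    ≤-trans (≤-reflexive (trans (size-plug p′ outs) (+-identityʳ k′))) (≤-trans cost (≤-reflexive (+-identityʳ c))) ,
    λ e o → trans (run-plug p′ outs (inp e) o) (wireOf-eval (holds · o) e)
    where
    open Extension (build d ε g)
    outs = out (λ o → wireOf (holds · o))

  dual-cong : ∀ {s t} → (∀ e → s e ≡ t e) → dual s ⊨ dual t
  dual-cong s≗t h = rails λ r → sig-cong (λ e → cong (rail r) (s≗t e)) (h ↾ r)

  dual-not : ∀ {s} → dual s ⊨ dual (not ∘ s)
  dual-not {s} h = rails λ where
    true  → h ↾ false
    false → sig-cong (λ e → sym (not-involutive (s e))) (h ↾ true)

  forRails : ∀ {G c s} → (∀ r → G ⊢[ c ] sig (λ e → rail r (s e))) → G ⊢[ 2 * c ] dual s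
  forRails d = to (λ h → rails (h ·_)) (forBool d)

  dual-∧ : ∀ {s t} → dual s ⊗ dual t ⊢[ 2 ] dual (λ e → s e ∧ t e)
  dual-∧ {s} {t} = forRails λ where
    true  → from (λ { (h , l) → h ↾ true , l ↾ true }) (gate-⊢ AND)
    false → to (sig-cong λ e → rail-∧ (s e) (t e)) (from (λ { (h , l) → h ↾ false , l ↾ false }) (gate-⊢ OR))

  dual-∨ : ∀ {s t} → dual s ⊗ dual t ⊢[ 2 ] dual (λ e → s e ∨ t e)
  dual-∨ {s} {t} = forRails λ where
    true  → from (λ { (h , l) → h ↾ true , l ↾ true }) (gate-⊢ OR)
    false → to (sig-cong λ e → rail-∨ (s e) (t e)) (from (λ { (h , l) → h ↾ false , l ↾ false }) (gate-⊢ AND))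

  -- A multiplexer uses both rails of its control but only one of its data, so monotone gates can
  -- switch data without complements.
  sig-select : ∀ c (u : E → Bool → Bool) b →
               dual c ⊗ all Bool (λ a → sig (λ e → u e a)) ⊢[ 3 ] sig (λ e → u e (c e xor b))
  sig-select c u b = to (sig-cong λ e → mux (c e) (u e))
    (cut (both (from (λ { (h , l) → h ↾ true , l · not b }) (gate-⊢ AND))
               (from (λ { (h , l) → h ↾ false , l · b }) (gate-⊢ AND)))
      (from (λ { (_ , h) → h }) (gate-⊢ OR)))
    where
    mux : ∀ c (u : Bool → Bool) → (c ∧ u (not b)) ∨ (not c ∧ u b) ≡ u (c xor b)
    mux true  u = ∨-identityʳ (u (not b))
    mux false u = refl

  dual-select : ∀ c (u : E → Bool → Bool) b →
                dual c ⊗ all Bool (λ a → dual (λ e → u e a)) ⊢[ 6 ] dual (λ e → u e (c e xor b))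
  dual-select c u b = forRails λ r →
    from (λ { (h , l) → h , table λ a → l · a ↾ r }) (sig-select c (λ e a → rail r (u e a)) b)

  forBits : ∀ {G c w} {u : E → Vec Bool w} → (∀ i → G ⊢[ c ] dual (λ e → lookup (u e) i)) → G ⊢[ w * c ] word u
  forBits {w = w} d = to (λ h → bits (h ·_)) (forFin w d)

  word-cong : ∀ {w} {u v : E → Vec Bool w} → (∀ e → u e ≡ v e) → word u ⊨ word v
  word-cong u≗v h = bits λ i → dual-cong (λ e → cong (λ x → lookup x i) (u≗v e)) (h ! i)

  word-select : ∀ {w} c (u : E → Bool → Vec Bool w) b →
                dual c ⊗ all Bool (λ a → word (λ e → u e a)) ⊢[ w * 6 ] word (λ e → u e (c e xor b))
  word-select c u b = forBits λ i →
    from (λ { (h , l) → h , table λ a → l · a ! i }) (dual-select c (λ e a → lookup (u e a) i) b)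

  word-head : ∀ {w} {u : E → Vec Bool (suc w)} → word u ⊨ dual (λ e → head (u e))
  word-head {u = u} h = dual-cong (λ e → lookup-head (u e)) (h ! zero)
    where
    lookup-head : ∀ {w} (x : Vec Bool (suc w)) → lookup x zero ≡ head x
    lookup-head (_ ∷ _) = refl

  word-tail : ∀ {w} {u : E → Vec Bool (suc w)} → word u ⊨ word (λ e → tail (u e))
  word-tail {u = u} h = bits λ i → dual-cong (λ e → lookup-tail (u e) i) (h ! suc i)
    where
    lookup-tail : ∀ {w} (x : Vec Bool (suc w)) i → lookup x (suc i) ≡ lookup (tail x) i
    lookup-tail (_ ∷ _) i = refl

  word-flip : ∀ {w} {u : E → Pos (suc w)} → word u ⊨ word (λ e → flip (u e))
  word-flip {u = u} h = bits λ where
      zero    → dual-cong (λ e → lookup-zero (u e)) (dual-not (h ! zero))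
      (suc i) → dual-cong (λ e → lookup-suc (u e) i) (h ! suc i)
    where
    lookup-zero : ∀ {w} (x : Pos (suc w)) → not (lookup x zero) ≡ lookup (flip x) zero
    lookup-zero (_ ∷ _) = refl
    lookup-suc : ∀ {w} (x : Pos (suc w)) i → lookup x (suc i) ≡ lookup (flip x) (suc i)
    lookup-suc (_ ∷ _) i = refl

  -- The basis has no constants. They are carried as a hypothesis until the matrix `Y` supplies
  -- them.
  constants : Goal
  constants = dual (λ _ → true)

  dual-const : ∀ b → constants ⊨ dual (λ _ → b)
  dual-const true  = id
  dual-const false = dual-not

  word-const : ∀ {w} (x : Vec Bool w) → constants ⊨ word (λ _ → x)
  word-const x h = bits λ i → dual-const (lookup x i) h

  word-ltb : ∀ {d} (a b : E → Pos d) → constants ⊗ word a ⊗ word b ⊢[ d * 8 ] dual (λ e → ltb (a e) (b e))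
  word-ltb {zero}  a b = free λ { (t , _) → dual-cong (λ e → ltb-[] (a e) (b e)) (dual-const false t) }
    where
    ltb-[] : (a b : Pos 0) → false ≡ ltb a b
    ltb-[] [] [] = refl
  word-ltb {suc d} a b = relax (≤-reflexive (+-comm (d * 8) 8)) (to (dual-cong λ e → ltb-∷ (a e) (b e))
    (cut (from (λ { (t , ha , hb) → t , word-tail ha , word-tail hb }) (word-ltb (λ e → tail (a e)) (λ e → tail (b e))))
    (from (λ { ((_ , ha , hb) , l) → dual-not (word-head ha) , word-head hb , l })
    (cut {b = 6} (from (λ { (x , y , _) → x , y }) dual-∧)
    (cut {b = 2} (cut (from (λ { ((x , y , _) , _) → x , y }) dual-∨)
                      (from (λ { (((_ , _ , l) , _) , xy) → xy , l }) dual-∧))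
         (from (λ { ((_ , x) , y) → x , y }) dual-∨))))))
    where
    ltb-∷ : ∀ {d} (a b : Pos (suc d)) →
            (not (head a) ∧ head b) ∨ ((not (head a) ∨ head b) ∧ ltb (tail a) (tail b)) ≡ ltb a b
    ltb-∷ (_ ∷ _) (_ ∷ _) = refl

  word-min : ∀ {d} (a b : E → Pos d) →
             constants ⊗ word a ⊗ word b ⊢[ d * 8 + d * 6 ] word (λ e → min (a e) (b e))
  word-min {d} a b = cut (from (λ { (t , ha , hb) → t , hb , ha }) (word-ltb b a))
    (to (word-cong λ e → if-xor (ltb (b e) (a e)))
    (from (λ { ((t , ha , hb) , l) → l , table λ { true → hb ; false → ha } })
      (word-select (λ e → ltb (b e) (a e)) (λ e c → if c then b e else a e) false)))
    where
    if-xor : ∀ c {x y : Pos d} → (if c xor false then y else x) ≡ (if c then y else x)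
    if-xor true  = refl
    if-xor false = refl

-- Circuits for sorting, switch settings and the network

settingsCost : ℕ → ℕ
settingsCost d = 3 ^ d * (1080 * (d * d))

module Components {V E : Set} (inp : E → V → Bool) where
  open Build inp

  family : ∀ {d w} → (E → Pos d → Vec Bool w) → Goal
  family {d} u = all (Pos d) λ x → word (λ e → u e x)

  module MergeCircuit {A : Set} (key : A → Bool) (item : (E → A) → Goal) (c : ℕ)
    (item-select : ∀ s (u : E → Bool → A) b →
                   dual s ⊗ all Bool (λ a → item (λ e → u e a)) ⊢[ c ] item (λ e → u e (s e xor b)))
    (item-key : ∀ {u : E → A} → item u ⊨ dual (λ e → key (u e))) where

    items : ∀ {d} → (E → Pos d → A) → Goal
    items {d} u = all (Pos d) λ x → item (λ e → u e x)

    merge-⊢ : ∀ d (u : E → Pos (suc d) → A) → items u ⊢[ 3 ^ d * (2 * c) ] items (λ e → merge key d (u e))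
    merge-⊢ zero u = relax (≤-reflexive (sym (+-identityʳ (2 * c))))
      (to (λ h → table λ { (b ∷ []) → h · b })
      (forBool λ b → from (λ h → item-key (h · (false ∷ [])) , table λ a → h · (a ∷ []))
        (item-select (λ e → key (u e (false ∷ []))) (λ e a → u e (a ∷ [])) b)))
    merge-⊢ (suc d) u = relax (≤-reflexive (lemma (3 ^ d) (2 * c)))
      (cut (forBool λ b → from (λ h → table λ x → h · switchBlocks (b ∷ x)) (merge-⊢ d (λ e x → u e (switchBlocks (b ∷ x)))))
      (to (λ { (h , l) → table λ x → outer h l (toMid x) })
      (keeping (from middle (merge-⊢ d (λ e x → outerMerges e (fromMid (true ∷ x))))))))
      where
      outerMerges : E → Pos (2 + d) → A
      outerMerges e = onHalves (λ _ → merge key d) (u e ∘ switchBlocks)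
      Merged : Goal
      Merged = items u ⊗ all Bool λ b → items (λ e → merge key d (λ x → u e (switchBlocks (b ∷ x))))
      pick : ∀ {k} {p : Prefix k} → p ⊩ Merged → ∀ y → p ⊩ item (λ e → outerMerges e y)
      pick (_ , h) (b ∷ y) = h · b · y
      middle : Merged ⊨ items (λ e x → outerMerges e (fromMid (true ∷ x)))
      middle h = table λ x → pick h (fromMid (true ∷ x))
      outer : ∀ {k} {p : Prefix k} → p ⊩ Merged →
              p ⊩ items (λ e → merge key d (λ x → outerMerges e (fromMid (true ∷ x)))) →
              ∀ z → p ⊩ item (λ e → onHalves (lowerMid key (merge key d)) (outerMerges e ∘ fromMid) z)
      outer h l (false ∷ y) = pick h (fromMid (false ∷ y))
      outer h l (true ∷ y)  = l · y
      lemma : ∀ x y → 2 * (x * y) + x * y ≡ (3 * x) * y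
      lemma = solve-∀

    -- Two sorts of half the length and the merge of their results each cost `3 ^ d * (2 * c)`, so
    -- sorting obeys the same recurrence as merging.
    sort-⊢ : ∀ d (u : E → Pos d → A) → items u ⊢[ 3 ^ d * (2 * c) ] items (λ e → sort key d (u e))
    sort-⊢ zero    u = relax z≤n (free id)
    sort-⊢ (suc d) u = relax (≤-reflexive (lemma (3 ^ d) (2 * c)))
      (cut (forBool λ b → from (λ h → table λ x → h · (b ∷ x)) (sort-⊢ d (λ e x → u e (b ∷ x))))
      (from (λ { (_ , h) → table λ { (b ∷ x) → h · b · x } }) (merge-⊢ d (λ e → onHalves (λ _ → sort key d) (u e)))))
      where
      lemma : ∀ x y → 2 * (x * y) + x * y ≡ (3 * x) * y
      lemma = solve-∀

  -- Sorting takes `3 ^ d * (12 * (d + w))`, and the two recursive calls at most two thirds of the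
  -- whole; `12` is the remaining third of `36`.
  routeCost : ℕ → ℕ → ℕ
  routeCost d w = 3 ^ d * (36 * (d + w))

  item : ∀ {d w} → (E → Item {w} d) → Goal
  item u = word (λ e → proj₁ (u e)) ⊗ word (λ e → proj₂ (u e))

  item-select : ∀ {d w} s (u : E → Bool → Item {w} d) b →
    dual s ⊗ all Bool (λ a → item (λ e → u e a)) ⊢[ d * 6 + w * 6 ] item (λ e → u e (s e xor b))
  item-select s u b = both
    (from (λ { (h , l) → h , table λ a → fst (l · a) }) (word-select s (λ e a → proj₁ (u e a)) b))
    (from (λ { (h , l) → h , table λ a → snd (l · a) }) (word-select s (λ e a → proj₂ (u e a)) b))

  item-topBit : ∀ {d w} {u : E → Item {w} (suc d)} → item u ⊨ dual (λ e → topBit (u e))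
  item-topBit h = word-head (fst h)

  route-⊢ : ∀ d {w} (u : E → Pos d → Item {w} d) →
            all (Pos d) (λ x → item (λ e → u e x)) ⊢[ routeCost d w ] family (λ e → route d (u e))
  route-⊢ zero    u = relax z≤n (free λ h → table λ x → snd (h · x))
  route-⊢ (suc d) {w} u = relax cost
    (cut (sort-⊢ (suc d) u)
    (from (λ { (_ , h) → h })
    (to (λ h → table λ { (b ∷ x) → h · b · x })
    (forBool λ b → from (λ h → table λ x → word-tail (fst (h · (b ∷ x))) , snd (h · (b ∷ x)))
      (route-⊢ d (λ e q → dropTop (sort topBit (suc d) (u e) (b ∷ q))))))))
    where
    open MergeCircuit (topBit {w} {d}) item (suc d * 6 + w * 6) item-select item-topBit
    lemma : ∀ x d w → 3 * x * (2 * ((1 + d) * 6 + w * 6)) + 2 * (x * (36 * (d + w))) + x * 72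
                    ≡ 3 * x * (36 * (1 + d + w))
    lemma = solve-∀
    cost : 3 ^ suc d * (2 * (suc d * 6 + w * 6)) + 2 * routeCost d w ≤ routeCost (suc d) w
    cost = ≤-trans (m≤m+n _ (3 ^ d * 72)) (≤-reflexive (lemma (3 ^ d) d w))

  opaque
    unfolding scatter
    scatter-⊢ : ∀ {d w} (k : E → Pos d → Pos d) (v : E → Pos d → Vec Bool w) →
                family k ⊗ family v ⊢[ routeCost d w ] family (λ e → scatter (k e) (v e))
    scatter-⊢ k v = from (λ { (h , l) → table λ x → h · x , l · x }) (route-⊢ _ (λ e x → k e x , v e x))

  module ColouringCircuit {d : ℕ} (π : E → Pos (suc d) → Pos (suc d)) where
    open module C e = Colouring (π e) public

    D B : ℕ
    D = suc d
    B = routeCost D D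

    Γ : Goal
    Γ = constants ⊗ family π

    inverse-⊢ : Γ ⊢[ B ] family inverse
    inverse-⊢ = from (λ { (t , h) → h , table λ x → word-const x t }) (scatter-⊢ π (λ _ → id))

    J-⊢ : Γ ⊢[ B + B ] family J
    J-⊢ = cut inverse-⊢ (from (λ { (_ , h) → h , table λ x → h · flip x }) (scatter-⊢ inverse (λ e → inverse e ∘ flip)))

    compose-⊢ : ∀ A v → family A ⊗ family v ⊢[ B ] family (λ e → compose e (A e) (v e))
    compose-⊢ A v = from (λ { (h , l) → table (λ x → word-flip (h · flip x)) , l }) (scatter-⊢ (λ e → flip ∘ A e ∘ flip) v)

    least-⊢ : ∀ i → Γ ⊢[ B + B + i * (B + B + 2 ^ D * (D * 8 + D * 6)) ]
              constants ⊗ family (λ e → power e i) ⊗ family (λ e → least e i)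
    least-⊢ zero = relax (m≤m+n (B + B) 0)
      (to (λ { ((t , _) , h) → t , table (λ x → word-flip (h · x)) , table λ x → word-const x t }) (keeping J-⊢))
    least-⊢ (suc i) = relax (≤-reflexive (lemma (B + B) (i * step) step))
      (cut (least-⊢ i)
      (from (λ { (_ , h) → h })
      (to (λ { ((t , _) , (A , _) , m) → t , A , m })
      (keeping (cut (both (from (λ { (_ , A , _) → A , A }) (compose-⊢ (λ e → power e i) (λ e → power e i)))
                          (from (λ { (_ , A , m) → A , m }) (compose-⊢ (λ e → power e i) (λ e → least e i))))
        (to (λ { (((_ , hl) , h)) → hl , h })
        (keeping (forPos D λ x → from (λ { ((t , _ , m) , _ , m′) → t , m · x , m′ · x })
          (word-min (λ e → least e i x) (λ e → compose e (power e i) (least e i) x))))))))))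
      where
      step : ℕ
      step = B + B + 2 ^ D * (D * 8 + D * 6)
      lemma : ∀ a b s → a + b + s ≡ a + (s + b)
      lemma = solve-∀

    colour-⊢ : Γ ⊢[ B + B + D * (B + B + 2 ^ D * (D * 8 + D * 6)) + 2 ^ d * (D * 8) ]
               all (Pos d) (λ p → dual (λ e → colour e p))
    colour-⊢ = cut (least-⊢ D) (forPos d λ p → from (λ { (_ , t , _ , m) → t , m · (true ∷ p) , m · (false ∷ p) })
      (word-ltb (λ e → leader e (true ∷ p)) (λ e → leader e (false ∷ p))))

    outlets-⊢ : Γ ⊗ all (Pos d) (λ p → dual (λ e → colour e p)) ⊢[ 2 * (2 ^ d * (D * 6)) ]
                all Bool (λ c → all (Pos d) λ p → word (λ e → π e ((c xor colour e p) ∷ p)))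
    outlets-⊢ = forBool λ c → forPos d λ p →
      to (word-cong λ e → cong (λ a → π e (a ∷ p)) (xor-comm (colour e p) c))
      (from (λ { ((_ , h) , l) → l · p , table λ a → h · (a ∷ p) })
        (word-select (λ e → colour e p) (λ e a → π e (a ∷ p)) c))

    level-⊢ : Γ ⊢[ 3 ^ D * (360 * (D * D)) ]
              all (Pos d) (λ p → dual (λ e → colour e p)) ⊗
              all (Pos d) (λ p → dual (λ e → entry e p)) ⊗
              all Bool (λ c → family (λ e → subperm e c))
    level-⊢ = relax cost
      (cut colour-⊢
      (to (λ { ((_ , l) , (s , t)) → l , table (λ p → word-head (t · p)) , s })
      (keeping (cut outlets-⊢
        (to (λ { ((_ , o) , t) → table (λ c → table λ p → word-tail (o · c · p)) , t })
        (keeping (from (λ { (_ , o) → table (λ p → word-tail (o · false · p)) ,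
                                      table (λ p → bits λ { zero → word-head (o · false · p) }) })
          (scatter-⊢ (λ e → subperm e false) (λ e p → head (π e (colour e p ∷ p)) ∷ [])))))))))
      where
      cost : B + B + D * (B + B + 2 ^ D * (D * 8 + D * 6)) + 2 ^ d * (D * 8)
             + (2 * (2 ^ d * (D * 6)) + routeCost d 1) ≤ 3 ^ D * (360 * (D * D))
      cost = begin
        B + B + D * (B + B + 2 ^ D * (D * 8 + D * 6)) + 2 ^ d * (D * 8) + (2 * (2 ^ d * (D * 6)) + routeCost d 1)
          ≤⟨ +-mono-≤ (+-mono-≤ (+-monoʳ-≤ (B + B) (*-monoʳ-≤ D (+-monoʳ-≤ (B + B) (bound (*-monoʳ-≤ 2 2^≤3^)))))
                                (bound 2^≤3^))
                      (+-monoˡ-≤ (routeCost d 1) (*-monoʳ-≤ 2 (bound 2^≤3^))) ⟩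
        B + B + D * (B + B + 2 * 3 ^ d * (D * 8 + D * 6)) + 3 ^ d * (D * 8) + (2 * (3 ^ d * (D * 6)) + routeCost d 1)
          -- In units of `3 ^ d * D` the sum is `948 + 460 * d` and the target `1080 * D`; this is
          -- the difference.
          ≤⟨ m≤m+n _ (3 ^ d * D * (132 + 620 * d)) ⟩
        B + B + D * (B + B + 2 * 3 ^ d * (D * 8 + D * 6)) + 3 ^ d * (D * 8) + (2 * (3 ^ d * (D * 6)) + routeCost d 1)
          + 3 ^ d * D * (132 + 620 * d)
          ≡⟨ lemma (3 ^ d) d ⟩
        3 ^ D * (360 * (D * D)) ∎
        where
        open ≤-Reasoning
        2^≤3^ : 2 ^ d ≤ 3 ^ d
        2^≤3^ = ^-monoˡ-≤ d (n≤1+n 2)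
        bound : ∀ {x y z} → x ≤ y → x * z ≤ y * z
        bound {z = z} = *-monoˡ-≤ z
        lemma : ∀ x d → let D = 1 + d ; B = 3 * x * (36 * (D + D)) in
          B + B + D * (B + B + 2 * x * (D * 8 + D * 6)) + x * (D * 8) + (2 * (x * (D * 6)) + x * (36 * (d + 1)))
            + x * D * (132 + 620 * d) ≡ 3 * x * (360 * (D * D))
        lemma = solve-∀

  settings-⊢ : ∀ d (π : E → Pos d → Pos d) →
               constants ⊗ family π ⊢[ settingsCost d ] all (Ctl d) (λ k → dual (λ e → settings d (π e) k))
  settings-⊢ zero    π = relax z≤n (free λ _ → table λ ())
  settings-⊢ (suc d) π = relax cost
    (cut level-⊢
    (to (λ { ((_ , l , t , _) , s) → table λ where
               (inj₁ (inj₁ p)) → t · p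
               (inj₁ (inj₂ p)) → l · p
               (inj₂ (c , k))  → s · c · k })
    (keeping (forBool λ c → from (λ { ((t , _) , _ , _ , s) → t , s · c }) (settings-⊢ d (λ e → subperm e c))))))
    where
    open ColouringCircuit π
    cost : 3 ^ D * (360 * (D * D)) + 2 * settingsCost d ≤ settingsCost (suc d)
    -- The subnetworks take at most two thirds of the target, the level the third that `360` is of
    -- `1080`.
    cost = ≤-trans (m≤m+n _ (3 ^ d * (2160 * (1 + 2 * d)))) (≤-reflexive (lemma (3 ^ d) d))
      where
      lemma : ∀ x d → let D = 1 + d in
        3 * x * (360 * (D * D)) + 2 * (x * (1080 * (d * d))) + x * (2160 * (1 + 2 * d)) ≡ 3 * x * (1080 * (D * D))
      lemma = solve-∀

  -- Each of the `d` levels has a layer of input switches and one of output switches, `2 ^ d`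
  -- selectors of three gates apiece.
  beneš-⊢ : ∀ d (s : E → Ctl d → Bool) (x : E → Pos d → Bool) →
            all (Ctl d) (λ k → dual (λ e → s e k)) ⊗ all (Pos d) (λ p → sig (λ e → x e p))
            ⊢[ 2 ^ d * (6 * d) ] all (Pos d) (λ p → sig (λ e → beneš d (s e) (x e) p))
  beneš-⊢ zero    s x = relax z≤n (free snd)
  beneš-⊢ (suc d) s x = relax (≤-reflexive (lemma (2 ^ d) d))
    (cut (forBool λ c → forPos d λ p →
           from (λ { (h , l) → h · inj₁ (inj₁ p) , table λ a → l · (a ∷ p) })
             (sig-select (λ e → s e (inj₁ (inj₁ p))) (λ e a → x e (a ∷ p)) c))
    (cut (forBool λ c → from (λ { ((h , _) , l) → table (λ k → h · inj₂ (c , k)) , l · c })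
           (beneš-⊢ d (λ e k → s e (inj₂ (c , k))) (λ e p → x e ((s e (inj₁ (inj₁ p)) xor c) ∷ p))))
    (forPos (suc d) λ { (b ∷ q) →
      from (λ { (((h , _) , _) , l) → h · inj₁ (inj₂ q) , table λ c → l · c · q })
        (sig-select (λ e → s e (inj₁ (inj₂ q)))
          (λ e c → beneš d (λ k → s e (inj₂ (c , k))) (λ p → x e ((s e (inj₁ (inj₁ p)) xor c) ∷ p)) q) b) })))
    where
    lemma : ∀ x d → 2 * (x * 3) + (2 * (x * (6 * d)) + 2 * x * 3) ≡ 2 * x * (6 * (1 + d))
    lemma = solve-∀

-- Embedding Fin n into Pos d

module Embedding {n′ d : ℕ} (n≤2^d : suc n′ ≤ 2 ^ d) where

  private n = suc n′

  code : Fin n → Pos d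
  code i = Inverse.from (Pos↔Fin d) (inject≤ i n≤2^d)

  code-injective : Inj code
  code-injective eq = inject≤-injective n≤2^d n≤2^d _ _ (↔-to-injective (↔-sym (Pos↔Fin d)) eq)

  locate : ∀ p → Dec (∃[ i ] code i ≡ p)
  locate p = any? λ i → ≡-dec _≟ᵇ_ (code i) p

  decode : Pos d → Fin n
  decode p with locate p
  ... | yes (i , _) = i
  -- Padding inputs may carry anything. Repeating an existing variable avoids a constant.
  ... | no _        = zero

  decode-code : ∀ i → decode (code i) ≡ i
  decode-code i with locate (code i)
  ... | yes (j , eq) = code-injective eq
  ... | no ¬i        = contradiction (i , refl) ¬i

  extendId : (Fin n → Fin n) → Pos d → Pos d
  extendId π p with locate p
  ... | yes (i , _) = code (π i)
  ... | no _        = p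

  extendId-code : ∀ π i → extendId π (code i) ≡ code (π i)
  extendId-code π i with locate (code i)
  ... | yes (j , eq) = cong (code ∘ π) (code-injective eq)
  ... | no ¬i        = contradiction (i , refl) ¬i

  extendId-injective : ∀ {π} → Inj π → Inj (extendId π)
  extendId-injective {π} π-inj {p} {q} eq with locate p | locate q
  ... | yes (i , refl) | yes (j , refl) = cong code (π-inj (code-injective eq))
  ... | yes (i , _)    | no ¬j          = contradiction (π i , eq) ¬j
  ... | no ¬i          | yes (j , _)    = contradiction (π j , sym eq) ¬i
  ... | no _           | no _           = eq

  column : (Fin n × Fin n → Bool) → Fin n → Pos d → Bool
  column Y k p with locate p
  ... | yes (j , _) = Y (j , k)
  ... | no _        = false

  column-code : ∀ Y {j k} → Y (j , k) ≡ true → column Y k (code j) ≡ true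
  column-code Y {j} y with locate (code j)
  ... | yes (i , eq) rewrite code-injective eq = y
  ... | no ¬j        = contradiction (j , refl) ¬j

  column-unique : ∀ Y {j k} → (∀ i → Y (i , k) ≡ true → i ≡ j) → ∀ p → column Y k p ≡ true → p ≡ code j
  column-unique Y unique p y with locate p
  ... | yes (i , refl) = cong code (unique i y)

  module _ {π : Fin n → Fin n} (π-inj : Inj π) where

    extended-injective : Inj (extendId π)
    extended-injective = extendId-injective π-inj

    beneš-code : ∀ {A : Set} (x : Fin n → A) k →
                 beneš d (settings d (extendId π)) (x ∘ decode) (code k) ≡ x (π k)
    beneš-code x k = begin
      beneš d (settings d (extendId π)) (x ∘ decode) (code k) ≡⟨ beneš-correct d extended-injective (x ∘ decode) (code k) ⟩
      x (decode (extendId π (code k)))                        ≡⟨ cong (x ∘ decode) (extendId-code π k) ⟩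
      x (decode (code (π k)))                                 ≡⟨ cong x (decode-code (π k)) ⟩
      x (π k)                                                 ∎
      where open ≡-Reasoning

  module RowCircuit {V E : Set} (inp : E → V → Bool) where
    open Build inp
    open Components inp

    rows-⊢ : ∀ {q} (π : E → Fin n → Fin n) → (∀ e → Inj (π e)) → (X : E → Fin q → Fin n → Bool) →
             all (Ctl d) (λ k → dual (λ e → settings d (extendId (π e)) k)) ⊗
             all (Fin q) (λ i → all (Fin n) λ j → sig (λ e → X e i j))
             ⊢[ q * (2 ^ d * (6 * d)) ] all (Fin q × Fin n) (λ ik → sig (λ e → X e (proj₁ ik) (π e (proj₂ ik))))
    rows-⊢ {q} π π-inj X =
      to (λ h → table λ { (i , k) → sig-cong (λ e → beneš-code (π-inj e) (X e i) k) (h · i · code k) })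
      (forFin q λ i → from (λ { (s , h) → s , table λ p → h · i · decode p })
        (beneš-⊢ d (λ e → settings d (extendId (π e))) (λ e p → X e i (decode p))))

-- Reading a permutation matrix

anyOf : ∀ d → (Pos d → Bool) → Bool
anyOf zero    h = h []
anyOf (suc d) h = anyOf d (h ∘ (false ∷_)) ∨ anyOf d (h ∘ (true ∷_))

-- The disjunction of `h` over the positions whose bit `i` is `r`. For a single 1 it yields either
-- rail of the address bit without negation.
bitOf : ∀ d → Bool → (Pos d → Bool) → Fin d → Bool
bitOf (suc d) r h zero    = anyOf d (h ∘ (r ∷_))
bitOf (suc d) r h (suc i) = bitOf d r (h ∘ (false ∷_)) i ∨ bitOf d r (h ∘ (true ∷_)) i

anyOf-none : ∀ d {h} → (∀ p → h p ≡ false) → anyOf d h ≡ false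
anyOf-none zero    none = none []
anyOf-none (suc d) none = cong₂ _∨_ (anyOf-none d (none ∘ (false ∷_))) (anyOf-none d (none ∘ (true ∷_)))

bitOf-none : ∀ d r {h} → (∀ p → h p ≡ false) → ∀ i → bitOf d r h i ≡ false
bitOf-none (suc d) r none zero    = anyOf-none d (none ∘ (r ∷_))
bitOf-none (suc d) r none (suc i) =
  cong₂ _∨_ (bitOf-none d r (none ∘ (false ∷_)) i) (bitOf-none d r (none ∘ (true ∷_)) i)

anyOf-some : ∀ d {h} a → h a ≡ true → anyOf d h ≡ true
anyOf-some zero    []          h≡ = h≡
anyOf-some (suc d) {h} (false ∷ a) h≡ = cong (_∨ anyOf d (h ∘ (true ∷_))) (anyOf-some d a h≡)
anyOf-some (suc d) {h} (true ∷ a)  h≡ =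
  trans (cong (anyOf d (h ∘ (false ∷_)) ∨_) (anyOf-some d a h≡)) (∨-zeroʳ _)

bitOf-one : ∀ d r {h} a → h a ≡ true → (∀ p → h p ≡ true → p ≡ a) → ∀ i → bitOf d r h i ≡ rail r (lookup a i)
bitOf-one (suc d) r {h} (b ∷ a) h≡ only = bit r b h≡ only
  where
  none : ∀ {b} c → (∀ p → h p ≡ true → p ≡ b ∷ a) → c ≡ not b → ∀ p → h (c ∷ p) ≡ false
  none c only refl p = ¬-not λ y → not-¬ refl (sym (cong head (only (c ∷ p) y)))
  rest : ∀ {b} → (∀ p → h p ≡ true → p ≡ b ∷ a) → ∀ p → h (b ∷ p) ≡ true → p ≡ a
  rest only p y = cong tail (only _ y)
  bit : ∀ r b → h (b ∷ a) ≡ true → (∀ p → h p ≡ true → p ≡ b ∷ a) →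
        ∀ i → bitOf (suc d) r h i ≡ rail r (lookup (b ∷ a) i)
  bit true  true  h≡ only zero = anyOf-some d a h≡
  bit false false h≡ only zero = anyOf-some d a h≡
  bit true  false h≡ only zero = anyOf-none d (none true only refl)
  bit false true  h≡ only zero = anyOf-none d (none false only refl)
  bit r false h≡ only (suc i) = trans
    (cong₂ _∨_ (bitOf-one d r a h≡ (rest only) i) (bitOf-none d r (none true only refl) i)) (∨-identityʳ _)
  bit r true  h≡ only (suc i) =
    cong₂ _∨_ (bitOf-none d r (none false only refl) i) (bitOf-one d r a h≡ (rest only) i)

-- Disjunctions over subcubes are shared by all bits and both rails, which saves a factor `d`; the
-- `n` columns together then stay within `O(n²)`.
readCost : ℕ → ℕ
readCost zero    = 0
readCost (suc d) = 2 * readCost d + (1 + 2 * (d * 1))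

-- The recurrence has the exact solution `3 * 2 ^ d` minus `2 * d + 3`.
readCost-≤ : ∀ d → readCost d ≤ 3 * 2 ^ d
readCost-≤ d = ≤-trans (m≤m+n (readCost d) (2 * d + 3)) (≤-reflexive (exact d))
  where
  open ≡-Reasoning
  step : ∀ c d → 2 * c + (1 + 2 * (d * 1)) + (2 * (1 + d) + 3) ≡ 2 * (c + (2 * d + 3))
  step = solve-∀
  exact : ∀ d → readCost d + (2 * d + 3) ≡ 3 * 2 ^ d
  exact zero    = refl
  exact (suc d) = begin
    readCost (suc d) + (2 * suc d + 3) ≡⟨ step (readCost d) d ⟩
    2 * (readCost d + (2 * d + 3))     ≡⟨ cong (2 *_) (exact d) ⟩
    2 * (3 * 2 ^ d)                    ≡⟨ swap (2 ^ d) ⟩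
    3 * 2 ^ suc d                      ∎
    where
    swap : ∀ x → 2 * (3 * x) ≡ 3 * (2 * x)
    swap = solve-∀

module ReadCircuit {V E : Set} (inp : E → V → Bool) where
  open Build inp

  read-⊢ : ∀ d (h : E → Pos d → Bool) → all (Pos d) (λ p → sig (λ e → h e p))
           ⊢[ readCost d ] sig (λ e → anyOf d (h e)) ⊗ all Bool (λ r → all (Fin d) λ i → sig (λ e → bitOf d r (h e) i))
  read-⊢ zero    h = free λ l → l · [] , table λ r → table λ ()
  read-⊢ (suc d) h =
    cut (forBool λ b → from (λ l → table λ p → l · (b ∷ p)) (read-⊢ d (λ e p → h e (b ∷ p))))
    (from snd
    (to (λ { (l , a , m) → a , table λ r → table λ { zero → fst (l · r) ; (suc i) → m · r · i } })
    (keeping (both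
      (from (λ l → fst (l · false) , fst (l · true)) (gate-⊢ OR))
      (forBool λ r → forFin d λ i → from (λ l → snd (l · false) · r · i , snd (l · true) · r · i) (gate-⊢ OR))))))

-- Cost bounds

n≤2^⌈log₂n⌉ : ∀ n → n ≤ 2 ^ ⌈log₂ n ⌉
n≤2^⌈log₂n⌉ n = bound ⌈log₂ n ⌉ n refl
  where
  open ≤-Reasoning
  bound : ∀ L n → ⌈log₂ n ⌉ ≡ L → n ≤ 2 ^ L
  bound zero    0             eq = z≤n
  bound zero    1             eq = s≤s z≤n
  bound zero    (suc (suc n)) ()
  bound (suc L) n             eq = begin
    n                       ≡⟨ ⌊n/2⌋+⌈n/2⌉≡n n ⟨
    ⌊ n /2⌋ + ⌈ n /2⌉       ≤⟨ +-mono-≤ (≤-trans (⌊n/2⌋≤⌈n/2⌉ n) half≤) half≤ ⟩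
    2 ^ L + 2 ^ L           ≡⟨ cong (2 ^ L +_) (+-identityʳ (2 ^ L)) ⟨
    2 ^ suc L               ∎
    where
    half≤ : ⌈ n /2⌉ ≤ 2 ^ L
    half≤ = bound L ⌈ n /2⌉ (trans (⌈log₂⌈n/2⌉⌉≡⌈log₂n⌉∸1 n) (cong (_∸ 1) eq))

2^⌈log₂n⌉≤2*n : ∀ n → 1 ≤ n → 2 ^ ⌈log₂ n ⌉ ≤ 2 * n
2^⌈log₂n⌉≤2*n n 1≤n with ⌈log₂ n ⌉ in eq
... | zero  = ≤-trans 1≤n (m≤m+n n _)
... | suc L = *-monoʳ-≤ 2 (≮⇒≥ λ n<2^L → 1+n≰n (begin
  suc L           ≡⟨ eq ⟨
  ⌈log₂ n ⌉       ≤⟨ ⌈log₂⌉-mono-≤ {n} {2 ^ L} (<⇒≤ n<2^L) ⟩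
  ⌈log₂ 2 ^ L ⌉   ≡⟨ ⌈log₂2^n⌉≡n L ⟩
  L               ∎))
  where open ≤-Reasoning

-- The lower-order terms make the induction go through.
d²*3^d≤21*4^d : ∀ d → (d * d + 6 * d + 21) * 3 ^ d ≤ 21 * 4 ^ d
d²*3^d≤21*4^d zero    = ≤-refl
d²*3^d≤21*4^d (suc d) = begin
  (suc d * suc d + 6 * suc d + 21) * (3 * 3 ^ d)                         ≤⟨ m≤m+n _ ((d * d) * 3 ^ d) ⟩
  (suc d * suc d + 6 * suc d + 21) * (3 * 3 ^ d) + (d * d) * 3 ^ d       ≡⟨ lemma d (3 ^ d) ⟩
  4 * ((d * d + 6 * d + 21) * 3 ^ d)                                     ≤⟨ *-monoʳ-≤ 4 (d²*3^d≤21*4^d d) ⟩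
  4 * (21 * 4 ^ d)                                                       ≡⟨ swap (4 ^ d) ⟩
  21 * 4 ^ suc d                                                         ∎
  where
  open ≤-Reasoning
  lemma : ∀ d x → ((1 + d) * (1 + d) + 6 * (1 + d) + 21) * (3 * x) + (d * d) * x ≡ 4 * ((d * d + 6 * d + 21) * x)
  lemma = solve-∀
  swap : ∀ x → 4 * (21 * x) ≡ 21 * (4 * x)
  swap = solve-∀

4^d≡2^d*2^d : ∀ d → 4 ^ d ≡ 2 ^ d * 2 ^ d
4^d≡2^d*2^d zero    = refl
4^d≡2^d*2^d (suc d) = trans (cong (4 *_) (4^d≡2^d*2^d d)) (lemma (2 ^ d))
  where
  lemma : ∀ x → 4 * (x * x) ≡ 2 * x * (2 * x)
  lemma = solve-∀

-- `84 = 21 * 4`, where the `4` comes from squaring the padded size `2 * n`.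
quadratic-cost : ∀ K d n → 2 ^ d ≤ 2 * n → 3 ^ d * (K * (d * d)) ≤ K * 84 * (n * n)
quadratic-cost K d n 2^d≤ = begin
  3 ^ d * (K * (d * d))                 ≡⟨ regroup (3 ^ d) K (d * d) ⟩
  K * (d * d * 3 ^ d)                   ≤⟨ *-monoʳ-≤ K (*-monoˡ-≤ (3 ^ d)
                                             (≤-trans (m≤m+n (d * d) (6 * d)) (m≤m+n _ 21))) ⟩
  K * ((d * d + 6 * d + 21) * 3 ^ d)    ≤⟨ *-monoʳ-≤ K (d²*3^d≤21*4^d d) ⟩
  K * (21 * 4 ^ d)                      ≡⟨ cong (λ x → K * (21 * x)) (4^d≡2^d*2^d d) ⟩
  K * (21 * (2 ^ d * 2 ^ d))            ≤⟨ *-monoʳ-≤ K (*-monoʳ-≤ 21 (*-mono-≤ 2^d≤ 2^d≤)) ⟩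
  K * (21 * (2 * n * (2 * n)))          ≡⟨ collect K n ⟩
  K * 84 * (n * n)                      ∎
  where
  open ≤-Reasoning
  regroup : ∀ x K y → x * (K * y) ≡ K * (y * x)
  regroup = solve-∀
  collect : ∀ K n → K * (21 * (2 * n * (2 * n))) ≡ K * 84 * (n * n)
  collect = solve-∀

rows-cost : ∀ q d n → 2 ^ d ≤ 2 * n → q * (2 ^ d * (6 * d)) ≤ 12 * (q * n * d)
rows-cost q d n 2^d≤ = ≤-trans (*-monoʳ-≤ q (*-monoˡ-≤ (6 * d) 2^d≤)) (≤-reflexive (lemma q n d))
  where
  lemma : ∀ q n d → q * (2 * n * (6 * d)) ≡ 12 * (q * n * d)
  lemma = solve-∀

-- Opaque, because unfolding a product with a large numeral is expensive.
opaque
  settingsFactor : ℕ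
  settingsFactor = 1080 * 84

  settingsCost-≤ : ∀ d n → 2 ^ d ≤ 2 * n → settingsCost d ≤ settingsFactor * (n * n)
  settingsCost-≤ = quadratic-cost 1080

-- Part (i): the code made of switch settings

module SelfRouting {n′ d : ℕ} (n≤2^d : suc n′ ≤ 2 ^ d) (2^d≤2n : 2 ^ d ≤ 2 * suc n′) where
  open Embedding {d = d} n≤2^d

  n : ℕ
  n = suc n′

  m : ℕ
  m = Ctl-count d * 2

  address : (Ctl d × Bool) ↔ Fin m
  address = ↔-sym *↔× ↔-∘ (Ctl↔Fin d ×-↔ ↔-sym 2↔Bool)

  perm-injective : (π : Permutation′ n) → Inj (π ⟨$⟩ʳ_)
  perm-injective π = ↔-to-injective π

  switches : Permutation′ n → Ctl d → Bool
  switches π = settings d (extendId (π ⟨$⟩ʳ_))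

  -- Every switch setting is stored together with its complement, which makes the code an antichain.
  codeword : Permutation′ n → Fin m → Bool
  codeword π a = let k , r = Inverse.from address a in rail r (switches π k)

  codeword-address : ∀ π k r → codeword π (Inverse.to address (k , r)) ≡ rail r (switches π k)
  codeword-address π k r = cong (λ kr → rail (proj₂ kr) (switches π (proj₁ kr))) (Inverse.strictlyInverseʳ address (k , r))

  settingCode : PermCode n (Fin m)
  settingCode .σ = codeword
  -- The network itself decodes: run on the identity, it returns the permutation from its settings.
  settingCode .injective π ρ eq i = begin
    π ⟨$⟩ʳ i                                         ≡⟨ beneš-code (perm-injective π) id i ⟨
    beneš d (switches π) decode (code i)            ≡⟨ beneš-cong d same (λ _ → refl) (code i) ⟩
    beneš d (switches ρ) decode (code i)            ≡⟨ beneš-code (perm-injective ρ) id i ⟩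
    ρ ⟨$⟩ʳ i                                         ∎
    where
    open ≡-Reasoning
    same : ∀ k → switches π k ≡ switches ρ k
    same k = trans (sym (codeword-address π k true)) (trans (eq _) (codeword-address ρ k true))
  settingCode .antichain π ρ le a = cong (rail (proj₂ (Inverse.from address a))) (equal _ _ (at true) (at false))
    where
    k = proj₁ (Inverse.from address a)
    equal : ∀ x y → rail true x ≤ᵇ rail true y → rail false x ≤ᵇ rail false y → x ≡ y
    equal x     .x b≤b l = refl
    equal false true f≤t ()
    at : ∀ r → rail r (switches π k) ≤ᵇ rail r (switches ρ k)
    at r = subst₂ _≤ᵇ_ (codeword-address π k r) (codeword-address ρ k r) (le _)

  module _ (q : ℕ) where

    Env : Set
    Env = Permutation′ n × (Fin q → Fin n → Bool)

    input : Env → Input q n (Fin m) → Bool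
    input (π , X) = inputs X (codeword π)

    open Build input
    open RowCircuit input

    given : ε ⊩ all (Ctl d) (λ k → dual (λ e → switches (proj₁ e) k)) ⊗
                all (Fin q) (λ i → all (Fin n) λ j → sig (λ e → proj₂ e i j))
    given = table (λ k → rails λ r → wire (inj₁ (inj₂ (Inverse.to address (k , r)))) λ e → codeword-address (proj₁ e) k r) ,
            table λ i → table λ j → wire (inj₁ (inj₁ (i , j))) λ _ → refl

    selfRouting : ∃[ m ] Σ[ S ∈ PermCode n (Fin m) ] Σ[ C ∈ Circuit (Input q n (Fin m)) (Output q n) 0 ]
                  (ComputesPerm S C × size C ≤ 12 * (q * n * d))
    selfRouting =
      let C , size≤ , computes = circuit given
            (rows-⊢ (λ e → proj₁ e ⟨$⟩ʳ_) (λ e → perm-injective (proj₁ e)) proj₂)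
      in m , settingCode , C , (λ π X i k → computes (π , X) (i , k)) , ≤-trans size≤ (rows-cost q d n 2^d≤2n)

-- Part (ii): permutation matrices

module MatrixRouting {n″ d : ℕ} (q : ℕ) (n≤2^d : 2 + n″ ≤ 2 ^ d) (2^d≤2n : 2 ^ d ≤ 2 * (2 + n″)) where
  open Embedding {d = d} n≤2^d

  n : ℕ
  n = 2 + n″

  record Env : Set where
    field
      Y       : Fin n × Fin n → Bool
      Y-perm  : IsPermMatrix Y
      X       : Fin q → Fin n → Bool

    π : Fin n → Fin n
    π k = proj₁ (proj₁ Y-perm k)

    Y-π : ∀ k → Y (π k , k) ≡ true
    Y-π k = proj₁ (proj₂ (proj₁ Y-perm k))

    π-unique : ∀ k j → Y (j , k) ≡ true → j ≡ π k
    π-unique k = proj₂ (proj₂ (proj₁ Y-perm k))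

    π-injective : Inj π
    π-injective {k} {l} eq with k₀ , _ , unique ← proj₂ Y-perm (π k) =
      trans (unique k (Y-π k)) (sym (unique l (subst (λ j → Y (j , l) ≡ true) (sym eq) (Y-π l))))

    column-π : ∀ k → column Y k (code (π k)) ≡ true
    column-π k = column-code Y (Y-π k)

    column-π-unique : ∀ k p → column Y k p ≡ true → p ≡ code (π k)
    column-π-unique k = column-unique Y (π-unique k)

    -- The source of the constant `false`. It takes two entries of one column, hence `n ≥ 2`.
    one-row : Y (zero , zero) ∧ Y (suc zero , zero) ≡ false
    one-row with Y (zero , zero) in eq₀ | Y (suc zero , zero) in eq₁
    ... | false | _     = refl
    ... | true  | false = refl
    ... | true  | true  with () ← trans (π-unique zero zero eq₀) (sym (π-unique zero (suc zero) eq₁))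

  open Env

  input : Env → Input q n (Fin n × Fin n) → Bool
  input e = inputs (X e) (Y e)

  open Build input
  open Components input
  open RowCircuit input
  open ReadCircuit input

  Matrix Rows : Goal
  Matrix = all (Fin n × Fin n) λ jk → sig (λ e → Y e jk)
  Rows   = all (Fin q) (λ i → all (Fin n) λ j → sig (λ e → X e i j))

  given : ε ⊩ Matrix ⊗ Rows
  given = table (λ jk → wire (inj₁ (inj₂ jk)) λ _ → refl) ,
          table λ i → table λ j → wire (inj₁ (inj₁ (i , j))) λ _ → refl

  false-⊢ : Matrix ⊢[ 1 ] sig (λ _ → false)
  false-⊢ = to (sig-cong one-row) (from (λ h → h · (zero , zero) , h · (suc zero , zero)) (gate-⊢ AND))

  column-⊩ : ∀ {j} {p : Prefix j} → p ⊩ Matrix → p ⊩ sig (λ _ → false) → ∀ k x → p ⊩ sig (λ e → column (Y e) k x)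
  column-⊩ h f k x with locate x
  ... | yes (j , _) = h · (j , k)
  ... | no _        = f

  columns-⊢ : Matrix ⊗ sig (λ _ → false) ⊢[ n * readCost d ]
              all (Fin n) (λ k → sig (λ _ → true) ⊗ word (λ e → code (π e k)))
  columns-⊢ = forFin n λ k → to (λ { (a , l) →
      sig-cong (λ e → anyOf-some d (code (π e k)) (column-π e k)) a ,
      bits λ i → rails λ r → sig-cong (λ e → bitOf-one d r (code (π e k)) (column-π e k) (column-π-unique e k) i) (l · r · i) })
    (from (λ { (h , f) → table (column-⊩ h f k) }) (read-⊢ d (λ e → column (Y e) k)))

  extendId-⊩ : ∀ {j} {p : Prefix j} → p ⊩ constants → (∀ k → p ⊩ word (λ e → code (π e k))) →
               ∀ x → p ⊩ word (λ e → extendId (π e) x)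
  extendId-⊩ t h x with locate x
  ... | yes (k , _) = h k
  ... | no _        = word-const x t

  switches-⊢ : Matrix ⊢[ 1 + (n * readCost d + settingsCost d) ]
               all (Ctl d) (λ k → dual (λ e → settings d (extendId (π e)) k))
  switches-⊢ = cut false-⊢ (cut columns-⊢ (from (λ { ((_ , f) , h) →
      -- The disjunction of column zero is constantly `true`; with `f` it forms the two rails of a
      -- constant.
      let t = rails λ { true → fst (h · zero) ; false → f } in t , table (extendId-⊩ t (λ k → snd (h · k))) })
    (settings-⊢ d (λ e → extendId (π e)))))

  matrix-⊢ : Matrix ⊗ Rows ⊢[ 1 + (n * readCost d + settingsCost d) + q * (2 ^ d * (6 * d)) ]
             all (Fin q × Fin n) (λ ik → sig (λ e → X e (proj₁ ik) (π e (proj₂ ik))))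
  matrix-⊢ = cut (from fst switches-⊢) (from (λ { ((_ , x) , s) → s , x }) (rows-⊢ π π-injective X))

  cost : 1 + (n * readCost d + settingsCost d) + q * (2 ^ d * (6 * d)) ≤ (12 + settingsFactor) * (q * n * d + n * n)
  cost = begin
    1 + (n * readCost d + settingsCost d) + q * (2 ^ d * (6 * d))
      ≤⟨ +-mono-≤ (+-mono-≤ 1≤n*n (+-mono-≤ reads (settingsCost-≤ d n 2^d≤2n))) (rows-cost q d n 2^d≤2n) ⟩
    n * n + (n * (3 * (2 * n)) + settingsFactor * (n * n)) + 12 * (q * n * d)
      ≤⟨ collect (settingsFactor) n (q * n * d) ⟩
    (12 + settingsFactor) * (q * n * d + n * n) ∎
    where
    open ≤-Reasoning
    1≤n*n : 1 ≤ n * n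
    1≤n*n = s≤s z≤n
    reads : n * readCost d ≤ n * (3 * (2 * n))
    reads = *-monoʳ-≤ n (≤-trans (readCost-≤ d) (*-monoʳ-≤ 3 2^d≤2n))
    slack : ∀ K n z → n * n + (n * (3 * (2 * n)) + K * (n * n)) + 12 * z + (5 * (n * n) + K * z)
                    ≡ (12 + K) * (z + n * n)
    slack = solve-∀
    collect : ∀ K n z → n * n + (n * (3 * (2 * n)) + K * (n * n)) + 12 * z ≤ (12 + K) * (z + n * n)
    collect K n z = ≤-trans (m≤m+n _ (5 * (n * n) + K * z)) (≤-reflexive (slack K n z))

  matrixRouting : Σ[ C ∈ Circuit (Input q n (Fin n × Fin n)) (Output q n) 0 ]
                  (ComputesPerm₁ C × size C ≤ (12 + settingsFactor) * (q * n * d + n * n))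
  matrixRouting =
    let C , size≤ , computes = circuit given matrix-⊢
    in C , (λ Y Y-perm X i k j y →
              let e = record { Y = Y ; Y-perm = Y-perm ; X = X } in
              trans (computes e (i , k)) (cong (X i) (sym (π-unique e k j y)))) ,
       ≤-trans size≤ cost

open SelfRouting using (selfRouting)
open MatrixRouting using (matrixRouting)

theorem2 : (∃[ c ] (0 < c × (∀ (n q : ℕ) → 2 ≤ n → 1 ≤ q →
    ∃[ m ] Σ[ S ∈ PermCode n (Fin m) ] Σ[ C ∈ Circuit (Input q n (Fin m)) (Output q n) 0 ]
    (ComputesPerm S C × size C ≤ c * (q * n * ⌈log₂ n ⌉)))))
    ×
    (∃[ c ] (0 < c × (∀ (n q : ℕ) → 2 ≤ n → 1 ≤ q →
    Σ[ C ∈ Circuit (Input q n (Fin n × Fin n)) (Output q n) 0 ]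
    (ComputesPerm₁ C × size C ≤ c * (q * n * ⌈log₂ n ⌉ + n * n)))))
theorem2 =
  (12 , s≤s z≤n , λ { n@(suc _) q _ _ →
    selfRouting {d = ⌈log₂ n ⌉} (n≤2^⌈log₂n⌉ n) (2^⌈log₂n⌉≤2*n n (s≤s z≤n)) q }) ,
  (12 + settingsFactor , s≤s z≤n , λ where
    n@(suc (suc _)) q _ _ → matrixRouting {d = ⌈log₂ n ⌉} q (n≤2^⌈log₂n⌉ n) (2^⌈log₂n⌉≤2*n n (s≤s z≤n))
    1               q (s≤s ()) _)
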